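{- The decision problem LINEAR EXTENSION DIAMETER (LED) reduces, by a polynomial-time many-one reduction, to the decision problem WEAK DOMINANCE DRAWING FOR DIRECTED ACYCLIC GRAPHS (WDD).
   Context: LED. Instance: a finite poset $(A,P)$ ($P$ is a reflexive, antisymmetric, transitive relation on the finite set $A$, given explicitly) and a natural number $k$. Question: are there two linear extensions of $P$ with distance at least $k$? Here a linear extension of $P$ is a total order $L$ on $A$ such that $x\le y$ in $P$ implies $x\le y$ in $L$, and the distance $dist(L_i,L_j)$ of two linear extensions is the number of unordered pairs of elements of $A$ that appear in opposite order in $L_i$ and $L_j$. WDD. Instance: a finite directed acyclic graph $G=(V,E)$ and a positive integer $C$ such that $|E|\le C\le \frac{|V|(|V|-1)}{2}$. Question: do there exist two topological sortings $t_X,t_Y$ of $V$ whose intersection has cardinality $C$ or less? Here a topological sorting of $G$ is a bijection $t:V\to\{1,\dots,|V|\}$ such that $t(u)<t(v)$ for every edge $(u,v)\in E$, and the intersection of $t_X,t_Y$ is the set $I=\{(u,v)\in V\times V : t_X(u)<t_X(v),\ t_Y(u)<t_Y(v)\}$. The two topological sortings are allowed to coincide. -}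

module Defs where

open import Level using (Level; 0ℓ) renaming (suc to lsuc; _⊔_ to _⊔ˡ_)
open import Data.Bool.Base using (Bool; if_then_else_)
open import Data.Fin.Base as Fin using (Fin)
import Data.Fin.Properties as Fin
open import Data.List.Base as List
  using (List; []; _∷_; _++_; length; filter; allFin; concatMap; cartesianProduct)
open import Data.List.Relation.Unary.All using (All)
open import Data.Maybe.Base using (Maybe; just; nothing)
open import Data.Nat.Base using (ℕ; suc; _+_; _*_; _∸_; _≤_; _≥_; _<_)
open import Data.Nat.DivMod using (_/_)
open import Data.Nat.Binary.Base using (ℕᵇ; zero; 2[1+_]; 1+[2_]; fromℕ)
open import Data.Product.Base using (Σ-syntax; ∃-syntax; _×_; _,_)
open import Data.Sum.Base using (_⊎_)
open import Data.Vec.Base as Vec using (Vec; _∷_)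
open import Function.Bundles using (_↔_; _⇔_; _⤖_; module Bijection)
open import Relation.Binary.Construct.Closure.Transitive using (TransClosure)
open import Relation.Binary.Core using (Rel; _⇒_)
open import Relation.Binary.Definitions using (Decidable)
open import Relation.Binary.PropositionalEquality.Core using (_≡_)
open import Relation.Binary.Structures using (IsDecPartialOrder; IsDecTotalOrder)
open import Relation.Nullary.Decidable.Core using (does; _×-dec_; _⊎-dec_)
open import Relation.Nullary.Negation.Core using (¬_)

private
  variable
    a b ℓ ℓ′ : Level

------------------------------------------------------------------------
-- Deterministic multi-tape Turing machines

Finite : Set → Set
Finite A = ∃[ n ] (A ↔ Fin n)

data Symbol (Letter Work : Set) : Set where
  blank  : Symbol Letter Work
  letter : Letter → Symbol Letter Work
  work   : Work → Symbol Letter Work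

data Move : Set where
  L S R : Move

-- A two-way infinite tape. `left` lists the cells to the left of the
-- head, nearest first; cells beyond either list are blank.
record Tape (Letter Work : Set) : Set where
  constructor tape
  field
    left  : List (Symbol Letter Work)
    head  : Symbol Letter Work
    right : List (Symbol Letter Work)

open Tape public

module _ {Letter Work : Set} where

  emptyTape : Tape Letter Work
  emptyTape = tape [] blank []

  load : List Letter → Tape Letter Work
  load []      = emptyTape
  load (x ∷ w) = tape [] (letter x) (List.map letter w)

  write : Symbol Letter Work → Tape Letter Work → Tape Letter Work
  write s (tape l _ r) = tape l s r

  move : Move → Tape Letter Work → Tape Letter Work
  move L (tape []      h r)       = tape [] blank (h ∷ r)
  move L (tape (x ∷ l) h r)       = tape l x (h ∷ r)
  move S t                        = t
  move R (tape l       h [])      = tape (h ∷ l) blank []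
  move R (tape l       h (x ∷ r)) = tape (h ∷ l) x r

  -- The tape holds exactly w, with the head on the first letter of w
  -- (on an arbitrary blank cell if w is empty).
  Holds : Tape Letter Work → List Letter → Set
  Holds t w =
    All (_≡ blank) (left t) ×
    ∃[ pad ] (All (_≡ blank) pad × head t ∷ right t ≡ List.map letter w ++ pad)

-- The first tape is the input tape, the second one the output tape.
record Machine (Letter : Set) : Set₁ where
  field
    State       : Set
    stateFinite : Finite State
    Work        : Set
    workFinite  : Finite Work
    extraTapes  : ℕ

  tapes : ℕ
  tapes = 2 + extraTapes

  field
    start : State
    -- `nothing` means that the machine halts
    δ     : State → Vec (Symbol Letter Work) tapes →
            Maybe (State × Vec (Symbol Letter Work × Move) tapes)

module _ {Letter : Set} (M : Machine Letter) where
  open Machine M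

  record Config : Set where
    constructor config
    field
      state    : State
      contents : Vec (Tape Letter Work) tapes

  act : Symbol Letter Work × Move → Tape Letter Work → Tape Letter Work
  act (s , m) t = move m (write s t)

  step : Config → Maybe Config
  step (config q ts) with δ q (Vec.map head ts)
  ... | nothing        = nothing
  ... | just (q′ , as) = just (config q′ (Vec.zipWith act as ts))

  initial : List Letter → Config
  initial w = config start (load w ∷ Vec.replicate (suc extraTapes) emptyTape)

  -- c ⇓[ t ] d : started in c, the machine halts in d after exactly t steps
  data _⇓[_]_ : Config → ℕ → Config → Set where
    halt : ∀ {c} → step c ≡ nothing → c ⇓[ 0 ] c
    next : ∀ {c c′ d t} → step c ≡ just c′ → c′ ⇓[ t ] d → c ⇓[ suc t ] d

  outputTape : Config → Tape Letter Work
  outputTape (config _ (_ ∷ t ∷ _)) = t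

  OutputsOnWithin : (output input : List Letter) (bound : ℕ) → Set
  OutputsOnWithin v w bound =
    ∃[ t ] ∃[ d ] (t ≤ bound × initial w ⇓[ t ] d × Holds (outputTape d) v)

------------------------------------------------------------------------
-- Decision problems and polynomial-time many-one reductions

-- Coefficient list, constant term first
Polynomial : Set
Polynomial = List ℕ

eval : Polynomial → ℕ → ℕ
eval p n = List.foldr (λ c r → c + n * r) 0 p

record DecisionProblem (Letter : Set) a ℓ : Set (lsuc (a ⊔ˡ ℓ)) where
  field
    Instance : Set a
    encode   : Instance → List Letter
    Yes      : Instance → Set ℓ

open DecisionProblem public

module _ {Letter : Set} where

  -- Garey–Johnson convention: a reduction is a map between instances. The
  -- machine, fixed once for all inputs, is run on codes of instances only.
  PolyTimeComputable : (P : DecisionProblem Letter a ℓ) (Q : DecisionProblem Letter b ℓ′) →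
                       (Instance P → Instance Q) → Set (lsuc 0ℓ ⊔ˡ a)
  PolyTimeComputable P Q f =
    Σ[ M ∈ Machine Letter ] Σ[ p ∈ Polynomial ] (∀ x →
      OutputsOnWithin M (encode Q (f x)) (encode P x) (eval p (length (encode P x))))

  infix 4 _≤ₚ_

  _≤ₚ_ : DecisionProblem Letter a ℓ → DecisionProblem Letter b ℓ′ →
         Set (lsuc 0ℓ ⊔ˡ a ⊔ˡ b ⊔ˡ ℓ ⊔ˡ ℓ′)
  P ≤ₚ Q =
    Σ[ f ∈ (Instance P → Instance Q) ]
      (PolyTimeComputable P Q f × (∀ x → Yes P x ⇔ Yes Q (f x)))

------------------------------------------------------------------------
-- Encoding of relations and numbers as strings

data Letter : Set where
  𝟘 𝟙 ♯ : Letter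

bit : Bool → Letter
bit b = if b then 𝟙 else 𝟘

-- Adjacency matrix, row by row, each row terminated by ♯
encodeRel : ∀ {n} {_∼_ : Rel (Fin n) ℓ} → Decidable _∼_ → List Letter
encodeRel {n = n} _∼?_ =
  concatMap (λ x → List.map (λ y → bit (does (x ∼? y))) (allFin n) ++ ♯ ∷ []) (allFin n)

-- Bijective base 2, least significant digit first: 𝟘 and 𝟙 stand for
-- the digits 1 and 2. The length of the code of n is ⌊log₂ (1 + n)⌋.
encodeℕᵇ : ℕᵇ → List Letter
encodeℕᵇ zero     = []
encodeℕᵇ 1+[2 x ] = 𝟘 ∷ encodeℕᵇ x
encodeℕᵇ 2[1+ x ] = 𝟙 ∷ encodeℕᵇ x

-- The size of the ground set is the number of rows, so it need not be
-- written down separately.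
encodeRelℕ : ∀ {n} {_∼_ : Rel (Fin n) ℓ} → Decidable _∼_ → ℕ → List Letter
encodeRelℕ _∼?_ k = encodeRel _∼?_ ++ ♯ ∷ encodeℕᵇ (fromℕ k)

------------------------------------------------------------------------
-- Counting pairs

∣_∣ : ∀ {n} {_∼_ : Rel (Fin n) ℓ} → Decidable _∼_ → ℕ
∣_∣ {n = n} _∼?_ = length (filter (λ (x , y) → x ∼? y) (cartesianProduct (allFin n) (allFin n)))

------------------------------------------------------------------------
-- Linear extension diameter

record LEDInstance : Set₁ where
  field
    size              : ℕ
    _≼_               : Rel (Fin size) 0ℓ
    isDecPartialOrder : IsDecPartialOrder _≡_ _≼_
    k                 : ℕ

  open IsDecPartialOrder isDecPartialOrder public using () renaming (_≤?_ to _≼?_)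

-- A total order on a finite set is automatically decidable; the decision
-- procedure is part of the record so that disagreements can be counted.
record LinearExtension {n} (_≼_ : Rel (Fin n) 0ℓ) : Set₁ where
  field
    _⊑_             : Rel (Fin n) 0ℓ
    isDecTotalOrder : IsDecTotalOrder _≡_ _⊑_
    extends         : _≼_ ⇒ _⊑_

  open IsDecTotalOrder isDecTotalOrder public using () renaming (_≤?_ to _⊑?_)

module _ {n} {_≼_ : Rel (Fin n) 0ℓ} (L₁ L₂ : LinearExtension _≼_) where
  private
    module L₁ = LinearExtension L₁
    module L₂ = LinearExtension L₂

  -- The unordered pair {x, y} is represented by (x , y) with x Fin.< y.
  Reversed : Rel (Fin n) 0ℓ
  Reversed x y = x Fin.< y × ((x L₁.⊑ y × y L₂.⊑ x) ⊎ (y L₁.⊑ x × x L₂.⊑ y))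

  reversed? : Decidable Reversed
  reversed? x y =
    x Fin.<? y ×-dec ((x L₁.⊑? y ×-dec y L₂.⊑? x) ⊎-dec (y L₁.⊑? x ×-dec x L₂.⊑? y))

  dist : ℕ
  dist = ∣ reversed? ∣

LED : DecisionProblem Letter (lsuc 0ℓ) (lsuc 0ℓ)
LED = record
  { Instance = LEDInstance
  ; encode   = λ I → let open LEDInstance I in encodeRelℕ _≼?_ k
  ; Yes      = λ I → let open LEDInstance I in
                 Σ[ L₁ ∈ LinearExtension _≼_ ] Σ[ L₂ ∈ LinearExtension _≼_ ] dist L₁ L₂ ≥ k
  }

------------------------------------------------------------------------
-- Weak dominance drawing for directed acyclic graphs

record WDDInstance : Set₁ where
  field
    order   : ℕ
    Edge    : Rel (Fin order) 0ℓ
    edge?   : Decidable Edge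
    acyclic : ∀ v → ¬ TransClosure Edge v v
    C       : ℕ
    C>0     : 0 < C
    ∣E∣≤C   : ∣ edge? ∣ ≤ C
    C≤pairs : C ≤ order * (order ∸ 1) / 2

-- Positions are numbered from 0 rather than from 1.
record TopologicalSorting {n} (Edge : Rel (Fin n) 0ℓ) : Set where
  field
    bijection : Fin n ⤖ Fin n

  position : Fin n → Fin n
  position = Bijection.to bijection

  field
    monotone : ∀ {u v} → Edge u v → position u Fin.< position v

module _ {n} {Edge : Rel (Fin n) 0ℓ} (tX tY : TopologicalSorting Edge) where
  private
    module X = TopologicalSorting tX
    module Y = TopologicalSorting tY

  Intersection : Rel (Fin n) 0ℓ
  Intersection u v = X.position u Fin.< X.position v × Y.position u Fin.< Y.position v

  intersection? : Decidable Intersection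
  intersection? u v = X.position u Fin.<? X.position v ×-dec Y.position u Fin.<? Y.position v

WDD : DecisionProblem Letter (lsuc 0ℓ) 0ℓ
WDD = record
  { Instance = WDDInstance
  ; encode   = λ I → let open WDDInstance I in encodeRelℕ edge? C
  ; Yes      = λ I → let open WDDInstance I in
                 Σ[ tX ∈ TopologicalSorting Edge ] Σ[ tY ∈ TopologicalSorting Edge ]
                   ∣ intersection? tX tY ∣ ≤ C
  }

{-# OPTIONS --safe #-}

-- Put a path 0 → 1 → 2 below the strict order of P, with edges from 2, but not
-- from 0 or 1, to all elements of P. Let N = 3 + n be the order of this graph,
-- E its number of edges and T = N (N - 1) / 2. Two topological sortings restrict
-- to linear extensions of P at distance d, every pair of linear extensions
-- arises in this way, and the intersection I satisfies |I| + d = T because no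
-- pair involving 0, 1 or 2 is reversed. Take C = E + (T ∸ E ∸ k). If
-- E + k < T, then |I| ≤ C says d ≥ k. Otherwise C = E, and |I| ≤ C fails since I
-- contains all edges and the pair (0, 2).
--
-- The machine writes the matrix of the graph row by row and keeps E and T in
-- unary on two tapes. It then pops the T marks one by one: as long as E marks
-- are left each pop increments C, after that pops are first spent on
-- decrementing k, and the remaining ones increment C again.
module Submission where

open import Data.Bool.Base using (Bool; true; false; not; _∧_; _∨_; T)
open import Data.Bool.Properties using (T?)
open import Data.Empty using (⊥; ⊥-elim)
open import Data.Fin.Base as Fin using (Fin; zero; suc; toℕ)
import Data.Fin.Properties as Fin
open import Data.List.Base using
  (List; []; _∷_; _++_; _ʳ++_; length; map; replicate; tabulate; filter; allFin; cartesianProduct; concatMap)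
open import Data.List.Properties using
  (++-ʳ++; ʳ++-ʳ++; length-ʳ++; length-tabulate; length-++; map-tabulate; ++-identityʳ; ++-assoc; filter-++)
open import Data.List.Relation.Unary.All using (All; []; _∷_)
open import Data.Maybe.Base using (Maybe; just; nothing)
open import Data.Nat.Base
import Data.Nat.Binary.Base as Bin
open import Data.Nat.Binary.Base using (ℕᵇ; zero; 2[1+_]; 1+[2_])
import Data.Nat.Binary.Properties as Bin using (toℕ-fromℕ; fromℕ≡fromℕ')
open import Data.Nat.DivMod using (_/_; m*n/n≡m)
open import Data.Nat.Properties
open import Data.Nat.Tactic.RingSolver using (solve-∀)
open import Data.Product.Base using (Σ-syntax; ∃-syntax; _×_; _,_; proj₁; uncurry)
open import Data.Sum.Base using (inj₁; inj₂)
open import Data.Unit.Base using (⊤; tt)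
open import Data.Vec.Base using (Vec; []; _∷_)
open import Function.Base using (_∘_; id)
open import Function.Bundles using (mk⇔; mk⤖; mk↔ₛ′; Bijection)
open import Function.Consequences.Propositional using (strictlySurjective⇒surjective)
open import Function.Construct.Identity using (↔-id)
open import Function.Definitions using (Injective)
open import Level using (0ℓ)
open import Relation.Binary.Construct.Closure.Transitive using (TransClosure; [_]; _∷_)
open import Relation.Binary.Core using (Rel)
open import Relation.Binary.Definitions using (Decidable; Transitive; tri<; tri≈; tri>)
open import Relation.Binary.PropositionalEquality
open import Relation.Binary.Structures using (IsDecPartialOrder; IsDecTotalOrder)
open import Relation.Nullary.Decidable using (Dec; does; yes; no; dec-true; dec-false; does-⇔)
open import Relation.Nullary.Negation using (¬_; contradiction)
open import Algebra.Properties.CommutativeMonoid.Sum +-0-commutativeMonoid using (sum; ∑-distrib-+; sum-cong-≗)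

open import Defs

-- The reducing machine

-- a, b, c: write rows 0, 1, 2 of the output while scanning the first input row
-- forth, back and forth again, which supplies the number n of further columns.
-- r₀–r₂ write the columns 0, 1, 2 of a further row, r₃ copies up to the diagonal,
-- r₄ copies beyond it, and r₅ rewinds the fifth tape.
State : Set
State = Fin 26

pattern a₀ = zero
pattern a₁ = suc a₀
pattern a₂ = suc a₁
pattern a₃ = suc a₂
pattern b₀ = suc a₃
pattern b₁ = suc b₀
pattern b₂ = suc b₁
pattern b₃ = suc b₂
pattern c₀ = suc b₃
pattern c₁ = suc c₀
pattern c₂ = suc c₁
pattern c₃ = suc c₂
pattern c₄ = suc c₃
pattern r₀ = suc c₄
pattern r₁ = suc r₀
pattern r₂ = suc r₁
pattern r₃ = suc r₂
pattern r₄ = suc r₃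
pattern r₅ = suc r₄
pattern pop      = suc r₅
pattern decr     = suc pop
pattern decrBack = suc decr
pattern incr     = suc decrBack
pattern incrBack = suc incr
pattern rewind   = suc incrBack
pattern halted   = suc rewind

Cell : Set
Cell = Symbol Letter ⊤

Action : Set
Action = Cell × Move

stay : Cell → Action
stay s = s , S

put : Letter → Action
put x = letter x , R

mark : Cell
mark = letter ♯

push : Action
push = mark , R

go : State → (i o d u g : Action) → Maybe (State × Vec Action 5)
go q i o d u g = just (q , i ∷ o ∷ d ∷ u ∷ g ∷ [])

-- Tapes: input i, output o, one mark on d per edge written, one mark on u per
-- pair above the diagonal, and on g one mark per completed row, by which r₃ finds
-- the diagonal. The number k is decremented in place on i and C is built on o.
δ : State → (i o d u g : Cell) → Maybe (State × Vec Action 5)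
-- The head leaves the input to the left and returns in `a₁`, so that the blank in front of the
-- input becomes an explicit cell. On g the first cell stays blank and later stops `r₅`.
δ a₀ i o d u g = go a₁ (i , L) (put 𝟘) (stay d) (stay u) (g , R)
δ a₁ i o d u g = go a₂ (i , R) (put 𝟙) push push (stay g)
δ a₂ i o d u g = go a₃ (stay i) (put 𝟘) (stay d) push (stay g)
δ a₃ (letter ♯) o d u g = go b₀ (mark , L) (put ♯) (stay d) (stay u) (stay g)
δ a₃ (letter x) o d u g = go a₃ (letter x , R) (put 𝟘) (stay d) push (stay g)
δ b₀ i o d u g = go b₁ (stay i) (put 𝟘) (stay d) (stay u) (stay g)
δ b₁ i o d u g = go b₂ (stay i) (put 𝟘) (stay d) (stay u) (stay g)
δ b₂ i o d u g = go b₃ (stay i) (put 𝟙) push push (stay g)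
δ b₃ (letter x) o d u g = go b₃ (letter x , L) (put 𝟘) (stay d) push (stay g)
δ b₃ blank      o d u g = go c₀ (blank , R) (put ♯) (stay d) (stay u) (stay g)
δ c₀ i o d u g = go c₁ (stay i) (put 𝟘) (stay d) (stay u) (stay g)
δ c₁ i o d u g = go c₂ (stay i) (put 𝟘) (stay d) (stay u) (stay g)
δ c₂ i o d u g = go c₃ (stay i) (put 𝟘) (stay d) (stay u) (stay g)
δ c₃ (letter ♯) o d u g = go c₄ (mark , L) (put ♯) (stay d) (stay u) (stay g)
δ c₃ (letter x) o d u g = go c₃ (letter x , R) (put 𝟙) push push (stay g)
δ c₄ (letter x) o d u g = go c₄ (letter x , L) (stay o) (stay d) (stay u) (stay g)
δ c₄ blank      o d u g = go r₀ (blank , R) (stay o) (stay d) (stay u) (stay g)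
-- The separator in front of k starts the counting phase. The heads of d and u step back from the
-- blank behind the marks onto the last mark.
δ r₀ (letter ♯) o d u g = go pop (mark , R) (put ♯) (d , L) (u , L) (stay g)
δ r₀ (letter x) o d u g = go r₁ (stay (letter x)) (put 𝟘) (stay d) (stay u) (stay g)
δ r₁ i o d u g = go r₂ (stay i) (put 𝟘) (stay d) (stay u) (stay g)
δ r₂ i o d u g = go r₃ (stay i) (put 𝟘) (stay d) (stay u) (stay g)
-- The first blank on g marks the diagonal column. The entry is replaced by 0, and the mark written
-- on g accounts for the current row.
δ r₃ i          o d u blank      = go r₄ (i , R) (put 𝟘) (stay d) (stay u) (stay mark)
δ r₃ (letter 𝟘) o d u (letter x) = go r₃ (put 𝟘) (put 𝟘) (stay d) (stay u) (put x)
δ r₃ (letter 𝟙) o d u (letter x) = go r₃ (put 𝟙) (put 𝟙) push (stay u) (put x)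
δ r₄ (letter 𝟘) o d u g = go r₄ (put 𝟘) (put 𝟘) (stay d) push (stay g)
δ r₄ (letter 𝟙) o d u g = go r₄ (put 𝟙) (put 𝟙) push push (stay g)
δ r₄ (letter ♯) o d u g = go r₅ (put ♯) (put ♯) (stay d) (stay u) (stay g)
δ r₅ i o d u (letter x) = go r₅ (stay i) (stay o) (stay d) (stay u) (letter x , L)
δ r₅ i o d u blank      = go r₀ (stay i) (stay o) (stay d) (stay u) (blank , R)
δ pop i o d          blank      g = go rewind (stay i) (o , L) (stay d) (stay blank) (stay g)
δ pop i o (letter x) (letter y) g = go incr (stay i) (stay o) (letter x , L) (letter y , L) (stay g)
δ pop i o blank      (letter y) g = go decr (stay i) (stay o) (stay blank) (letter y , L) (stay g)
δ decr blank      o d u g = go incr (stay blank) (stay o) (stay d) (stay u) (stay g)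
δ decr (letter 𝟘) o d u g = go decrBack (stay (work tt)) (stay o) (stay d) (stay u) (stay g)
δ decr (letter 𝟙) o d u g = go decrBack (stay (letter 𝟘)) (stay o) (stay d) (stay u) (stay g)
-- Borrow: 0 - 1 = 1 - 2, so the digit becomes 1 and the next digit is decremented.
δ decr (work tt)  o d u g = go decr (put 𝟘) (stay o) (stay d) (stay u) (stay g)
δ decrBack (letter ♯) o d u g = go pop (put ♯) (stay o) (stay d) (stay u) (stay g)
δ decrBack i          o d u g = go decrBack (i , L) (stay o) (stay d) (stay u) (stay g)
δ incr i blank      d u g = go incrBack (stay i) (stay (letter 𝟘)) (stay d) (stay u) (stay g)
δ incr i (letter 𝟘) d u g = go incrBack (stay i) (stay (letter 𝟙)) (stay d) (stay u) (stay g)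
-- Carry in bijective base 2: 2 + 1 = 1 + 1 * 2.
δ incr i (letter 𝟙) d u g = go incr (stay i) (put 𝟘) (stay d) (stay u) (stay g)
δ incrBack i (letter ♯) d u g = go pop (stay i) (put ♯) (stay d) (stay u) (stay g)
δ incrBack i o          d u g = go incrBack (stay i) (o , L) (stay d) (stay u) (stay g)
δ rewind i (letter x) d u g = go rewind (stay i) (letter x , L) (stay d) (stay u) (stay g)
δ rewind i blank      d u g = go halted (stay i) (blank , R) (stay d) (stay u) (stay g)
δ _ _ _ _ _ _ = nothing

reducer : Machine Letter
reducer = record
  { State       = State
  ; stateFinite = 26 , ↔-id _
  ; Work        = ⊤
  ; workFinite  = 1 , mk↔ₛ′ (λ _ → zero) (λ _ → tt) (λ { zero → refl }) (λ _ → refl)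
  ; extraTapes  = 3
  ; start       = a₀
  ; δ           = λ { q (i ∷ o ∷ d ∷ u ∷ g ∷ []) → δ q i o d u g }
  }

-- Runs with a step bound

infix 3 _⟶⟨_⟩_
infixr 4 _▹_ _▹▹_

-- The index is an upper bound on the number of steps, not their exact number: `done` accepts every
-- b.
data _⟶⟨_⟩_ : Config reducer → ℕ → Config reducer → Set where
  done : ∀ {c b} → c ⟶⟨ b ⟩ c
  _▹_  : ∀ {c c′ d b} → step reducer c ≡ just c′ → c′ ⟶⟨ b ⟩ d → c ⟶⟨ suc b ⟩ d

weaken : ∀ {c d b b′} → b ≤ b′ → c ⟶⟨ b ⟩ d → c ⟶⟨ b′ ⟩ d
weaken _         done    = done
weaken (s≤s b≤b′) (e ▹ r) = e ▹ weaken b≤b′ r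

_▹▹_ : ∀ {c d e b b′} → c ⟶⟨ b ⟩ d → d ⟶⟨ b′ ⟩ e → c ⟶⟨ b + b′ ⟩ e
done {b = b} ▹▹ r = weaken (m≤n+m _ b) r
(e ▹ q)      ▹▹ r = e ▹ (q ▹▹ r)

halts : ∀ {c d b} → c ⟶⟨ b ⟩ d → step reducer d ≡ nothing → ∃[ t ] (t ≤ b × _⇓[_]_ reducer c t d)
halts done    h = 0 , z≤n , halt h
halts (e ▹ r) h with t , t≤b , run ← halts r h = suc t , s≤s t≤b , next e run

-- Defined through `move` so that one step of the machine to the right yields an
-- `at` definitionally, whatever lies to the right.
at : List Cell → List Cell → Tape Letter ⊤
at []      []      = emptyTape
at []      (x ∷ r) = tape [] x r
at (h ∷ l) r       = move R (tape l h r)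

unary : ℕ → Tape Letter ⊤
unary n = tape (replicate n mark) blank []

ones : List Letter → ℕ
ones []      = 0
ones (𝟙 ∷ w) = suc (ones w)
ones (_ ∷ w) = ones w

-- w is the output so far in reverse; it determines the tape d.
cfg : State → Tape Letter ⊤ → List Letter → ℕ → Tape Letter ⊤ → Config reducer
cfg q i w u g =
  config q (i ∷ tape (map letter w) blank [] ∷ unary (ones w) ∷ unary u ∷ g ∷ [])

-- Writing the adjacency matrix

row : ∀ {n} → (Fin n → Bool) → List Letter → List Letter
row g w = tabulate (bit ∘ g) ++ ♯ ∷ w

lines : ∀ {m n} → (Fin m → Fin n → Bool) → List Letter → List Letter
lines {zero}  M w = w
lines {suc m} M w = row (M zero) (lines (M ∘ suc) w)

a₃-bit : ∀ b {l r w u g} → step reducer (cfg a₃ (tape l (letter (bit b)) r) w u g) ≡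
         just (cfg a₃ (at (letter (bit b) ∷ l) r) (𝟘 ∷ w) (suc u) g)
a₃-bit false = refl
a₃-bit true  = refl

c₃-bit : ∀ b {l r w u g} → step reducer (cfg c₃ (tape l (letter (bit b)) r) w u g) ≡
         just (cfg c₃ (at (letter (bit b) ∷ l) r) (𝟙 ∷ w) (suc u) g)
c₃-bit false = refl
c₃-bit true  = refl

r₀-bit : ∀ b {l r w u g} → step reducer (cfg r₀ (tape l (letter (bit b)) r) w u g) ≡
         just (cfg r₁ (tape l (letter (bit b)) r) (𝟘 ∷ w) u g)
r₀-bit false = refl
r₀-bit true  = refl

r₃-bit : ∀ b {l r w u h l′ r′} →
         step reducer (cfg r₃ (tape l (letter (bit b)) r) w u (tape l′ (letter h) r′)) ≡
         just (cfg r₃ (at (letter (bit b) ∷ l) r) (bit b ∷ w) u (at (letter h ∷ l′) r′))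
r₃-bit false = refl
r₃-bit true  = refl

r₃-diagonal : ∀ b {l r w u l′ r′} →
  step reducer (cfg r₃ (tape l (letter (bit b)) r) w u (tape l′ blank r′)) ≡
  just (cfg r₄ (at (letter (bit b) ∷ l) r) (𝟘 ∷ w) u (tape l′ mark r′))
r₃-diagonal false = refl
r₃-diagonal true  = refl

r₄-bit : ∀ b {l r w u g} → step reducer (cfg r₄ (tape l (letter (bit b)) r) w u g) ≡
         just (cfg r₄ (at (letter (bit b) ∷ l) r) (bit b ∷ w) (suc u) g)
r₄-bit false = refl
r₄-bit true  = refl

infixl 6 _ʳ+_

-- Accumulating addition, in analogy to `_ʳ++_`: a push made before the recursive call then matches
-- the stated number of marks by computation.
_ʳ+_ : ℕ → ℕ → ℕ
zero  ʳ+ u = u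
suc n ʳ+ u = n ʳ+ suc u

ʳ+≡+ : ∀ n u → n ʳ+ u ≡ n + u
ʳ+≡+ zero    u = refl
ʳ+≡+ (suc n) u = trans (ʳ+≡+ n (suc u)) (+-suc n u)

zeros : ℕ → List Letter
zeros n = replicate n 𝟘

-- A scan and the way back are one induction: the recursive call covers everything
-- that happens between leaving a cell and returning to it.
ab-rows : ∀ bs {h l rest w u g} →
  let input = map letter (map bit bs ++ ♯ ∷ rest); n = length bs in
  cfg a₃ (at (h ∷ l) input) w u g ⟶⟨ 2 * n + 4 ⟩
  cfg b₃ (tape l h input) (zeros n ++ 𝟙 ∷ 𝟘 ∷ 𝟘 ∷ ♯ ∷ (zeros n ʳ++ w)) (n + suc (n ʳ+ u)) g
ab-rows []       = refl ▹ refl ▹ refl ▹ refl ▹ done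
ab-rows (b ∷ bs) =
  weaken (≤-reflexive (lemma (length bs)))
    (a₃-bit b ▹ ab-rows bs ▹▹ refl ▹ done {b = 0})
  where
  lemma : ∀ n → suc (2 * n + 4 + 1) ≡ 2 * suc n + 4
  lemma = solve-∀

c-row : ∀ bs {h l rest w u g} →
  let input = map letter (map bit bs ++ ♯ ∷ rest); n = length bs in
  cfg c₃ (at (h ∷ l) input) w u g ⟶⟨ 2 * n + 1 ⟩
  cfg c₄ (tape l h input) (♯ ∷ (replicate n 𝟙 ʳ++ w)) (n ʳ+ u) g
c-row []       = refl ▹ done
c-row (b ∷ bs) =
  weaken (≤-reflexive (lemma (length bs)))
    (c₃-bit b ▹ c-row bs ▹▹ refl ▹ done {b = 0})
  where
  lemma : ∀ n → suc (2 * n + 1 + 1) ≡ 2 * suc n + 1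
  lemma = solve-∀

offDiagonal : ∀ {n} → Fin n → (Fin n → Bool) → Fin n → Bool
offDiagonal x g y = not (does (x Fin.≟ y)) ∧ g y

above : ∀ {n} → Fin n → ℕ
above {suc n} zero    = n
above         (suc x) = above x

above-diagonal : ∀ {n} (g : Fin n → Bool) {h l rest w u t} →
  cfg r₄ (at (h ∷ l) (map letter (row g rest))) w u t ⟶⟨ n + 1 ⟩
  cfg r₅ (at (mark ∷ (map letter (tabulate (bit ∘ g)) ʳ++ h ∷ l)) (map letter rest))
         (♯ ∷ (tabulate (bit ∘ g) ʳ++ w)) (n ʳ+ u) t
above-diagonal {zero}  g = refl ▹ done
above-diagonal {suc n} g = r₄-bit (g zero) ▹ above-diagonal (g ∘ suc)

-- `r₃` passes one mark of g per column left of the diagonal, and `r₅` passes the same marks on the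
-- way back. Both passes form one induction on x, so g ends with its head on `h′` and with one mark
-- more.
whole-row : ∀ {n} (x : Fin n) (g : Fin n → Bool) {h l rest w u h′ l′} →
  cfg r₃ (at (h ∷ l) (map letter (row g rest))) w u (at (h′ ∷ l′) (replicate (toℕ x) mark)) ⟶⟨ 2 * n + 2 ⟩
  cfg r₅ (at (mark ∷ (map letter (tabulate (bit ∘ g)) ʳ++ h ∷ l)) (map letter rest))
         (♯ ∷ (tabulate (bit ∘ offDiagonal x g) ʳ++ w)) (above x ʳ+ u)
         (tape l′ h′ (replicate (suc (toℕ x)) mark))
whole-row {suc n} zero g =
  weaken (≤-trans (m≤m+n _ (suc n)) (≤-reflexive (lemma n)))
    (r₃-diagonal (g zero) ▹ above-diagonal (g ∘ suc) ▹▹ refl ▹ done {b = 0})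
  where
  lemma : ∀ n → suc (n + 1 + 1) + suc n ≡ 2 * suc n + 2
  lemma = solve-∀
whole-row {suc n} (suc x) g =
  weaken (≤-reflexive (lemma n))
    (r₃-bit (g zero) ▹ whole-row x (g ∘ suc) ▹▹ refl ▹ done {b = 0})
  where
  lemma : ∀ n → suc (2 * n + 2 + 1) ≡ 2 * suc n + 2
  lemma = solve-∀

-- The element of `Fin n` shows that the row is nonempty: `r₀` then reads a bit and not the
-- separator in front of k.
indent : ∀ {n} → Fin n → (g : Fin n → Bool) → ∀ {h l rest w u t} →
  cfg r₀ (at (h ∷ l) (map letter (row g rest))) w u t ⟶⟨ 3 ⟩
  cfg r₃ (at (h ∷ l) (map letter (row g rest))) (𝟘 ∷ 𝟘 ∷ 𝟘 ∷ w) u t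
indent {suc n} _ g = r₀-bit (g zero) ▹ refl ▹ refl ▹ done

r₅-rewind : ∀ j {i w u} →
  cfg r₅ i w u (tape [] blank (replicate (suc j) mark)) ⟶⟨ 1 ⟩
  cfg r₀ i w u (at (blank ∷ []) (replicate (suc j) mark))
r₅-rewind j = refl ▹ done

module _ {n} (M : Fin n → Fin n → Bool) where

  padded : Fin n → Fin (3 + n) → Bool
  padded x zero                = false
  padded x (suc zero)          = false
  padded x (suc (suc zero))    = false
  padded x (suc (suc (suc y))) = offDiagonal x (M x) y

  graph : Fin (3 + n) → Fin (3 + n) → Bool
  graph zero                zero                = false
  graph zero                (suc zero)          = true
  graph zero                (suc (suc y))       = false
  graph (suc zero)          (suc (suc zero))    = true
  graph (suc zero)          _                   = false
  graph (suc (suc zero))    (suc (suc (suc y))) = true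
  graph (suc (suc zero))    _                   = false
  graph (suc (suc (suc x))) y                   = padded x y

  pushes : ∀ {m} → (Fin m → Fin n) → ℕ → ℕ
  pushes {zero}  x u = u
  pushes {suc m} x u = pushes (x ∘ suc) (above (x zero) ʳ+ u)

  -- The induction removes rows while the number n of columns stays fixed. The m remaining rows are
  -- therefore selected by x; they start at row j, and j is also the number of marks on g.
  all-rows : ∀ {m} j (x : Fin m → Fin n) → (∀ i → toℕ (x i) ≡ j + toℕ i) → ∀ {h l rest w u} →
    ∃[ h′ ] ∃[ l′ ] ∃[ t ] (
      cfg r₀ (at (h ∷ l) (map letter (lines (M ∘ x) rest))) w u (at (blank ∷ []) (replicate j mark))
      ⟶⟨ m * (2 * n + 6) ⟩
      cfg r₀ (at (h′ ∷ l′) (map letter rest)) (lines (padded ∘ x) [] ʳ++ w) (pushes x u) t)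
  all-rows {zero}  j x eq = _ , _ , _ , done
  all-rows {suc m} j x eq {h} {l} {rest} {w} {u}
    with h′ , l′ , t , run ← all-rows (suc j) (x ∘ suc) (λ i → trans (eq (suc i)) (+-suc j (toℕ i)))
                                {mark} {map letter (tabulate (bit ∘ M (x zero))) ʳ++ h ∷ l} {rest}
                                {♯ ∷ (tabulate (bit ∘ padded (x zero)) ʳ++ w)} {above (x zero) ʳ+ u}
    rewrite ++-ʳ++ (tabulate (bit ∘ padded (x zero))) {♯ ∷ lines (padded ∘ x ∘ suc) []} {w}
    -- Identifies j with `toℕ (x zero)`, the number of marks that `whole-row` expects.
    with refl ← trans (eq zero) (+-identityʳ j) =
    h′ , l′ , t ,
    weaken (≤-reflexive (lemma n (m * (2 * n + 6))))
      (indent (x zero) (M (x zero)) ▹▹ whole-row (x zero) (M (x zero)) ▹▹ r₅-rewind (toℕ (x zero)) ▹▹ run)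
    where
    lemma : ∀ n r → 3 + (2 * n + 2 + (1 + r)) ≡ 2 * n + 6 + r
    lemma = solve-∀

tabulate-const : ∀ n {x : Letter} → tabulate {n = n} (λ _ → x) ≡ replicate n x
tabulate-const zero    = refl
tabulate-const (suc n) = cong (_ ∷_) (tabulate-const n)

replicate-∷ : ∀ n {x : Letter} w → replicate n x ++ x ∷ w ≡ x ∷ replicate n x ++ w
replicate-∷ zero    w = refl
replicate-∷ (suc n) w = cong (_ ∷_) (replicate-∷ n w)

replicate-ʳ++ : ∀ n {x : Letter} w → replicate n x ʳ++ w ≡ replicate n x ++ w
replicate-ʳ++ zero    w = refl
replicate-ʳ++ (suc n) w = trans (replicate-ʳ++ n (_ ∷ w)) (replicate-∷ n w)

header : ℕ → List Letter
header n = ♯ ∷ (replicate n 𝟙 ʳ++ 𝟘 ∷ 𝟘 ∷ 𝟘 ∷ ♯ ∷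
           (zeros n ++ 𝟙 ∷ 𝟘 ∷ 𝟘 ∷ ♯ ∷ (zeros n ʳ++ 𝟘 ∷ 𝟙 ∷ 𝟘 ∷ [])))

headerPushes : ℕ → ℕ
headerPushes n = n ʳ+ (n + suc (n ʳ+ 2))

-- The tail of row 1 is written on the way back and so appears in the opposite order; it consists of
-- zeros only, and a constant word equals its reverse.
graph-header : ∀ {n} (M : Fin n → Fin n → Bool) →
               lines (padded M) [] ʳ++ header n ≡ lines (graph M) [] ʳ++ []
graph-header {n} M
  rewrite tabulate-const n {𝟘} | tabulate-const n {𝟙}
        | sym (replicate-ʳ++ n {𝟘} (𝟙 ∷ 𝟘 ∷ 𝟘 ∷ ♯ ∷ (zeros n ʳ++ 𝟘 ∷ 𝟙 ∷ 𝟘 ∷ [])))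
  = sym (trans (++-ʳ++ (zeros n)) (trans (++-ʳ++ (zeros n)) (++-ʳ++ (replicate n 𝟙))))

-- For n = 0 the separator in front of k serves as the end of an empty first row.
first-row : ∀ {n} (M : Fin n → Fin n → Bool) w → ∃[ bs ] ∃[ rest ]
            (lines M (♯ ∷ w) ≡ map bit bs ++ ♯ ∷ rest × length bs ≡ n)
first-row {zero}  M w = [] , w , refl , refl
first-row {suc n} M w =
  tabulate (M zero) , lines (M ∘ suc) (♯ ∷ w) ,
  cong (_++ ♯ ∷ lines (M ∘ suc) (♯ ∷ w)) (sym (map-tabulate (M zero) bit)) , length-tabulate (M zero)

header-rows : ∀ {n} bs rest → length bs ≡ n → let input = map bit bs ++ ♯ ∷ rest in
  initial reducer input ⟶⟨ 4 * n + 13 ⟩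
  cfg r₀ (at (blank ∷ []) (map letter input)) (header n) (headerPushes n) (at (blank ∷ []) [])
header-rows bs rest refl =
  weaken (≤-reflexive (lemma (length bs)))
    (begin-input bs ▹ refl ▹ refl ▹ ab-rows bs ▹▹
     refl ▹ refl ▹ refl ▹ refl ▹ c-row bs ▹▹ refl ▹ done {b = 0})
  where
  begin-input : ∀ bs → let input = map bit bs ++ ♯ ∷ rest in
    step reducer (initial reducer input) ≡
    just (cfg a₁ (tape [] blank (map letter input)) (𝟘 ∷ []) 0 (at (blank ∷ []) []))
  begin-input []       = refl
  begin-input (b ∷ bs) = refl

  lemma : ∀ n → 3 + (2 * n + 4 + (4 + (2 * n + 1 + 1))) ≡ 4 * n + 13
  lemma = solve-∀

matrix : ∀ {n} (M : Fin n → Fin n → Bool) w → ∃[ h ] ∃[ l ] ∃[ t ] (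
  initial reducer (lines M (♯ ∷ w)) ⟶⟨ 4 * n + 13 + n * (2 * n + 6) ⟩
  cfg r₀ (at (h ∷ l) (map letter (♯ ∷ w))) (lines (graph M) [] ʳ++ [])
         (pushes M (λ x → x) (headerPushes n)) t)
matrix {n} M w
  with bs , rest , eq , len ← first-row M w
  with h , l , t , run ← all-rows M 0 (λ x → x) (λ _ → refl) {blank} {[]} {♯ ∷ w} {header n} {headerPushes n}
  rewrite sym (graph-header M) =
  h , l , t , (header-run ▹▹ run)
  where
  header-run : initial reducer (lines M (♯ ∷ w)) ⟶⟨ 4 * n + 13 ⟩
    cfg r₀ (at (blank ∷ []) (map letter (lines M (♯ ∷ w)))) (header n) (headerPushes n) (at (blank ∷ []) [])
  header-run = subst
    (λ v → initial reducer v ⟶⟨ _ ⟩ cfg r₀ (at (blank ∷ []) (map letter v)) (header n) (headerPushes n) _)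
    (sym eq) (header-rows bs rest len)

-- Counting in binary

-- The digit 0 allows a borrow to leave the length of the number unchanged.
data Digit : Set where
  0# 1# 2# : Digit

symbol : Digit → Cell
symbol 0# = work tt
symbol 1# = letter 𝟘
symbol 2# = letter 𝟙

digit : Digit → ℕ
digit 0# = 0
digit 1# = 1
digit 2# = 2

value : List Digit → ℕ
value []       = 0
value (d ∷ ds) = digit d + 2 * value ds

digits : ℕᵇ → List Digit
digits zero     = []
digits 1+[2 x ] = 1# ∷ digits x
digits 2[1+ x ] = 2# ∷ digits x

value-digits : ∀ x → value (digits x) ≡ Bin.toℕ x
value-digits zero     = refl
value-digits 1+[2 x ] = cong (λ v → suc (2 * v)) (value-digits x)
value-digits 2[1+ x ] = trans (cong (λ v → suc (suc (2 * v))) (value-digits x)) (lemma (Bin.toℕ x))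
  where
  lemma : ∀ v → 2 + 2 * v ≡ 2 * suc v
  lemma = solve-∀

symbol-digits : ∀ x → map letter (encodeℕᵇ x) ≡ map symbol (digits x)
symbol-digits zero     = refl
symbol-digits 1+[2 x ] = cong (letter 𝟘 ∷_) (symbol-digits x)
symbol-digits 2[1+ x ] = cong (letter 𝟙 ∷_) (symbol-digits x)

binary : ℕᵇ → List Cell
binary x = map letter (encodeℕᵇ x)

-- The carry and the way back are one induction, with two steps per digit passed; the head ends on
-- the cell h in front of the number.
increment : ∀ c {i h l d u g} →
  config incr (i ∷ at (h ∷ l) (binary c) ∷ d ∷ u ∷ g ∷ []) ⟶⟨ 2 * length (encodeℕᵇ c) + 2 ⟩
  config incrBack (i ∷ tape l h (binary (Bin.suc c)) ∷ d ∷ u ∷ g ∷ [])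
increment zero     = refl ▹ refl ▹ done
increment 1+[2 c ] = weaken (m≤n+m 2 (2 * length (encodeℕᵇ 1+[2 c ]))) (refl ▹ refl ▹ done)
increment 2[1+ c ] = weaken (≤-reflexive (lemma (length (encodeℕᵇ c))))
  (refl ▹ increment c ▹▹ refl ▹ done {b = 0})
  where
  lemma : ∀ n → suc (2 * n + 2 + 1) ≡ 2 * suc n + 2
  lemma = solve-∀

decrement : ∀ ds {v h l o d u g} → value ds ≡ suc v → ∃[ ds′ ] (value ds′ ≡ v × length ds′ ≡ length ds ×
  (config decr (at (h ∷ l) (map symbol ds) ∷ o ∷ d ∷ u ∷ g ∷ []) ⟶⟨ 2 * length ds + 2 ⟩
   config decrBack (tape l h (map symbol ds′) ∷ o ∷ d ∷ u ∷ g ∷ [])))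
decrement (1# ∷ ds) refl =
  0# ∷ ds , refl , refl , weaken (m≤n+m 2 (2 * length (1# ∷ ds))) (refl ▹ refl ▹ done)
decrement (2# ∷ ds) refl =
  1# ∷ ds , refl , refl , weaken (m≤n+m 2 (2 * length (2# ∷ ds))) (refl ▹ refl ▹ done)
decrement (0# ∷ ds) eq with value ds in eq′
-- Borrowing replaces 0 + 2 (v + 1) by 1 + 2 v.
decrement (0# ∷ ds) refl | suc v
  with ds′ , refl , len , run ← decrement ds eq′ =
  1# ∷ ds′ , sym (+-suc v (v + 0)) , cong suc len ,
  weaken (≤-reflexive (lemma (length ds))) (refl ▹ run ▹▹ refl ▹ done {b = 0})
  where
  lemma : ∀ n → suc (2 * n + 2 + 1) ≡ 2 * suc n + 2
  lemma = solve-∀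

-- All digits are `0#`, so the borrow runs off the end. It leaves wrong digits behind, which does no
-- harm because the head never returns to them.
exhaust : ∀ ds {h l o d u g} → value ds ≡ 0 → ∃[ l′ ]
  (config decr (at (h ∷ l) (map symbol ds) ∷ o ∷ d ∷ u ∷ g ∷ []) ⟶⟨ length ds ⟩
   config decr (tape l′ blank [] ∷ o ∷ d ∷ u ∷ g ∷ []))
exhaust []        eq = _ , done
exhaust (0# ∷ ds) eq with l′ , run ← exhaust ds (m+n≡0⇒m≡0 (value ds) eq) = l′ , (refl ▹ run)

-- The counting loop

Produces : Config reducer → ℕ → List Letter → Set
Produces c b w = ∃[ d ] (c ⟶⟨ b ⟩ d × step reducer d ≡ nothing × Holds (outputTape reducer d) w)

infixr 4 _▹ₚ_

_▹ₚ_ : ∀ {c d b b′ w} → c ⟶⟨ b ⟩ d → Produces d b′ w → Produces c (b + b′) w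
r ▹ₚ (e , run , stop , holds) = e , (r ▹▹ run) , stop , holds

weakenₚ : ∀ {c b b′ w} → b ≤ b′ → Produces c b w → Produces c b′ w
weakenₚ b≤b′ (e , run , stop , holds) = e , weaken b≤b′ run , stop , holds

holds-at : ∀ w {pad} → All (_≡ blank) pad → Holds (at (blank ∷ []) (map letter w ++ pad)) w
holds-at []      []       = refl ∷ [] , blank ∷ [] , refl ∷ [] , refl
holds-at []      (p ∷ ps) = refl ∷ [] , _ , p ∷ ps , refl
holds-at (x ∷ w) ps       = refl ∷ [] , _ , ps , refl

map-letter-ʳ++ : ∀ (l : List Letter) w (pad : List Cell) →
                 map letter l ʳ++ (map letter w ++ pad) ≡ map letter (l ʳ++ w) ++ pad
map-letter-ʳ++ []      w pad = refl
map-letter-ʳ++ (x ∷ l) w pad = map-letter-ʳ++ l (x ∷ w) pad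

rewind-all : ∀ l {s r i d u g} →
  config rewind (i ∷ move L (tape (map letter l) s r) ∷ d ∷ u ∷ g ∷ []) ⟶⟨ length l + 1 ⟩
  config halted (i ∷ at (blank ∷ []) (map letter l ʳ++ s ∷ r) ∷ d ∷ u ∷ g ∷ [])
rewind-all []      = refl ▹ done
rewind-all (x ∷ l) = refl ▹ rewind-all l

-- If w is empty, the head has visited the blank behind the separator, and this cell becomes padding
-- in `Holds`.
finish : ∀ l w {i d r g} →
  Produces (config pop (i ∷ at (mark ∷ map letter l) (map letter w) ∷ d ∷ tape [] blank r ∷ g ∷ []))
           (2 + (length l + 1)) (l ʳ++ ♯ ∷ w)
finish l [] =
  _ , (refl ▹ refl ▹ rewind-all l) , refl ,
  subst (λ v → Holds (at (blank ∷ []) v) (l ʳ++ ♯ ∷ [])) (sym (map-letter-ʳ++ l (♯ ∷ []) (blank ∷ [])))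
        (holds-at (l ʳ++ ♯ ∷ []) (refl ∷ []))
finish l (x ∷ w) =
  _ , (refl ▹ refl ▹ rewind-all l) , refl ,
  subst (λ v → Holds (at (blank ∷ []) v) (l ʳ++ ♯ ∷ x ∷ w))
        (trans (sym (map-letter-ʳ++ l (♯ ∷ x ∷ w) []))
               (cong (λ v → map letter l ʳ++ mark ∷ letter x ∷ v) (++-identityʳ _)))
        (holds-at (l ʳ++ ♯ ∷ x ∷ w) [])

data Remaining (κ : ℕ) : ℕ → Tape Letter ⊤ → Set where
  digits-left : ∀ {l ds} → length ds ≤ κ → Remaining κ (value ds) (at (mark ∷ l) (map symbol ds))
  -- A failed decrement leaves the head on the blank behind the digits, where
  -- every later decrement fails at once.
  used-up     : ∀ {l} → Remaining κ 0 (tape l blank [])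

popped : ℕ → Cell → List Cell → Tape Letter ⊤
popped n s r = move L (tape (replicate n mark) s r)

-- The counting loop on numbers: u and d marks are left on their tapes, v is what is left of k, and
-- e is the value reached on the output tape.
tally : ℕ → ℕ → ℕ → ℕ → ℕ
tally zero    d       v       e = e
tally (suc u) (suc d) v       e = tally u d v (suc e)
tally (suc u) zero    (suc v) e = tally u zero v e
tally (suc u) zero    zero    e = tally u zero zero (suc e)

length-suc : ∀ x → length (encodeℕᵇ (Bin.suc x)) ≤ suc (length (encodeℕᵇ x))
length-suc zero     = s≤s z≤n
length-suc 1+[2 x ] = n≤1+n _
length-suc 2[1+ x ] = s≤s (length-suc x)

length-fromℕ : ∀ e → length (encodeℕᵇ (Bin.fromℕ' e)) ≤ e
length-fromℕ zero    = z≤n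
length-fromℕ (suc e) = ≤-trans (length-suc (Bin.fromℕ' e)) (s≤s (length-fromℕ e))

module _ (κ β : ℕ) (l : List Letter) where

  -- One pop takes at most a walk over the digits of k and one over those of C, each forth and back,
  -- and a few changes of state. Here κ bounds the digits of k and β those of C.
  popCost : ℕ
  popCost = 2 * κ + 2 * β + 8

  budget : ℕ → ℕ
  budget u = u * popCost + (2 + (length l + 1))

  -- Every increment is paid for by a pop, so `u + e` never grows. The invariant `u + e ≤ β` thus
  -- bounds the value of C, and with it the number of its digits, throughout the loop.
  count : ∀ u d {v i} → Remaining κ v i → ∀ e → u + e ≤ β → ∀ {s r s′ r′ g} →
    Produces
      (config pop (i ∷ at (mark ∷ map letter l) (binary (Bin.fromℕ' e)) ∷ popped d s r ∷ popped u s′ r′ ∷ g ∷ []))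
      (budget u)
      (l ʳ++ ♯ ∷ encodeℕᵇ (Bin.fromℕ' (tally u d v e)))

  within : ∀ u a {r} → r ≡ a + budget u → a ≤ popCost → r ≤ budget (suc u)
  within u a refl a≤ =
    ≤-trans (+-monoˡ-≤ (budget u) a≤) (≤-reflexive (sym (+-assoc popCost (u * popCost) _)))

  count-up : ∀ u d {v i} → Remaining κ v i → ∀ e → u + suc e ≤ β → ∀ {s r s′ r′ g} →
    Produces
      (config incr (i ∷ at (mark ∷ map letter l) (binary (Bin.fromℕ' e)) ∷ popped d s r ∷ popped u s′ r′ ∷ g ∷ []))
      (2 * β + 3 + budget u)
      (l ʳ++ ♯ ∷ encodeℕᵇ (Bin.fromℕ' (tally u d v (suc e))))
  count-up u d rem e bound {g = g} =
    weakenₚ (+-monoˡ-≤ (budget u) lemma)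
      ((increment (Bin.fromℕ' e) ▹▹ refl ▹ done {b = 0}) ▹ₚ count u d rem (suc e) bound)
    where
    lemma : 2 * length (encodeℕᵇ (Bin.fromℕ' e)) + 2 + 1 ≤ 2 * β + 3
    lemma = ≤-trans (≤-reflexive (+-assoc _ 2 1))
      (+-monoˡ-≤ 3 (*-monoʳ-≤ 2 (≤-trans (length-fromℕ e) (≤-trans (n≤1+n e) (≤-trans (m≤n+m (suc e) u) bound)))))

  count zero    d       rem e bound = finish l (encodeℕᵇ (Bin.fromℕ' e))
  count (suc u) (suc d) rem e bound =
    weakenₚ (within u (2 * β + 4) (lemma β (budget u)) (+-mono-≤ (m≤n+m (2 * β) (2 * κ)) (m≤m+n 4 4)))
      ((refl ▹ done {b = 0}) ▹ₚ count-up u d rem e (≤-trans (≤-reflexive (+-suc u e)) bound))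
    where
    lemma : ∀ β y → 1 + (2 * β + 3 + y) ≡ 2 * β + 4 + y
    lemma = solve-∀
  count (suc u) zero used-up e bound =
    weakenₚ (within u (2 * β + 5) (lemma β (budget u)) (+-mono-≤ (m≤n+m (2 * β) (2 * κ)) (m≤m+n 5 3)))
      ((refl ▹ refl ▹ done {b = 0}) ▹ₚ count-up u zero used-up e (≤-trans (≤-reflexive (+-suc u e)) bound))
    where
    lemma : ∀ β y → 2 + (2 * β + 3 + y) ≡ 2 * β + 5 + y
    lemma = solve-∀
  count (suc u) zero {v} (digits-left {ds = ds} len) e bound with value ds in eq
  ... | zero with l′ , run ← exhaust ds eq =
    weakenₚ (within u (length ds + 2 * β + 5) (lemma (length ds) β (budget u))
              (+-mono-≤ (+-monoˡ-≤ (2 * β) (≤-trans len (m≤m+n κ _))) (m≤m+n 5 3)))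
      ((refl ▹ done {b = 0}) ▹ₚ run ▹ₚ (refl ▹ done {b = 0}) ▹ₚ
       count-up u zero used-up e (≤-trans (≤-reflexive (+-suc u e)) bound))
    where
    lemma : ∀ n β y → 1 + (n + (1 + (2 * β + 3 + y))) ≡ n + 2 * β + 5 + y
    lemma = solve-∀
  ... | suc v with ds′ , refl , len′ , run ← decrement ds eq =
    weakenₚ (within u (2 * length ds + 4) (lemma (length ds) (budget u))
              (+-mono-≤ (≤-trans (*-monoʳ-≤ 2 len) (m≤m+n (2 * κ) (2 * β))) (m≤m+n 4 4)))
      ((refl ▹ done {b = 0}) ▹ₚ run ▹ₚ (refl ▹ done {b = 0}) ▹ₚ
       count u zero (digits-left (≤-trans (≤-reflexive len′) len)) e (≤-trans (n≤1+n _) bound))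
    where
    lemma : ∀ n y → 1 + (2 * n + 2 + (1 + y)) ≡ 2 * n + 4 + y
    lemma = solve-∀

-- Output and running time

tri : ℕ → ℕ
tri zero    = 0
tri (suc n) = n + tri n

sum-above : ∀ n → sum (above {n}) ≡ tri n
sum-above zero    = refl
sum-above (suc n) = cong (n +_) (sum-above n)

module _ {n} (M : Fin n → Fin n → Bool) where

  pushes≡ : ∀ {m} (x : Fin m → Fin n) u → pushes M x u ≡ sum (above ∘ x) + u
  pushes≡ {zero}  x u = refl
  pushes≡ {suc m} x u = begin
    pushes M (x ∘ suc) (above (x zero) ʳ+ u)            ≡⟨ pushes≡ (x ∘ suc) _ ⟩
    sum (above ∘ x ∘ suc) + (above (x zero) ʳ+ u)       ≡⟨ cong (sum (above ∘ x ∘ suc) +_) (ʳ+≡+ (above (x zero)) u) ⟩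
    sum (above ∘ x ∘ suc) + (above (x zero) + u)        ≡⟨ lemma (sum (above ∘ x ∘ suc)) _ u ⟩
    above (x zero) + sum (above ∘ x ∘ suc) + u          ∎
    where
    open ≡-Reasoning
    lemma : ∀ s a u → s + (a + u) ≡ a + s + u
    lemma = solve-∀

  all-pushes : pushes M (λ x → x) (headerPushes n) ≡ tri (3 + n)
  all-pushes = begin
    pushes M (λ x → x) (headerPushes n)    ≡⟨ pushes≡ (λ x → x) _ ⟩
    sum (above {n}) + headerPushes n       ≡⟨ cong₂ _+_ (sum-above n) (ʳ+≡+ n _) ⟩
    tri n + (n + (n + suc (n ʳ+ 2)))       ≡⟨ cong (λ s → tri n + (n + (n + suc s))) (ʳ+≡+ n 2) ⟩
    tri n + (n + (n + suc (n + 2)))        ≡⟨ lemma (tri n) n ⟩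
    tri (3 + n)                            ∎
    where
    open ≡-Reasoning
    lemma : ∀ t n → t + (n + (n + suc (n + 2))) ≡ 2 + n + (1 + n + (n + t))
    lemma = solve-∀

tri≤ : ∀ n → tri n ≤ n * n
tri≤ zero    = z≤n
tri≤ (suc n) = +-mono-≤ (n≤1+n n) (≤-trans (tri≤ n) (*-monoʳ-≤ n (n≤1+n n)))

lines-++ : ∀ {m n} (M : Fin m → Fin n → Bool) v w → lines M v ++ w ≡ lines M (v ++ w)
lines-++ {zero}  M v w = refl
lines-++ {suc m} M v w =
  trans (++-assoc (tabulate (bit ∘ M zero)) _ w)
        (cong (λ r → tabulate (bit ∘ M zero) ++ ♯ ∷ r) (lines-++ (M ∘ suc) v w))

length-lines : ∀ {m n} (M : Fin m → Fin n → Bool) w → length (lines M w) ≡ m * suc n + length w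
length-lines {zero}      M w = refl
length-lines {suc m} {n} M w = begin
  length (tabulate (bit ∘ M zero) ++ ♯ ∷ lines (M ∘ suc) w)           ≡⟨ length-++ (tabulate (bit ∘ M zero)) ⟩
  length (tabulate (bit ∘ M zero)) + suc (length (lines (M ∘ suc) w))
    ≡⟨ cong₂ (λ a b → a + suc b) (length-tabulate (bit ∘ M zero)) (length-lines (M ∘ suc) w) ⟩
  n + suc (m * suc n + length w)                                      ≡⟨ lemma n (m * suc n) (length w) ⟩
  suc m * suc n + length w                                            ∎
  where
  open ≡-Reasoning
  lemma : ∀ n r w → n + suc (r + w) ≡ suc n + r + w
  lemma = solve-∀

length-digits : ∀ x → length (digits x) ≡ length (encodeℕᵇ x)
length-digits zero     = refl
length-digits 1+[2 x ] = cong suc (length-digits x)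
length-digits 2[1+ x ] = cong suc (length-digits x)

-- The expansion of `steps` at the bounds used in `steps≡runtime`. The input length N bounds n and
-- the number of digits of k; there are at most (3 + N)² pairs, and the matrix has 3 + n rows of 4 +
-- n letters.
runtime : Polynomial
runtime = 263 ∷ 299 ∷ 131 ∷ 26 ∷ 2 ∷ []

-- The summands stand for rows 0 to 2, the n copied rows, the step into `pop`, and the counting loop
-- with the final rewinding.
steps : (n κ u w : ℕ) → ℕ
steps n κ u w = 4 * n + 13 + n * (2 * n + 6) + suc (u * (2 * κ + 2 * u + 8) + (2 + (w + 1)))

steps-mono : ∀ {n n′ κ κ′ u u′ w w′} → n ≤ n′ → κ ≤ κ′ → u ≤ u′ → w ≤ w′ →
             steps n κ u w ≤ steps n′ κ′ u′ w′
steps-mono n≤ κ≤ u≤ w≤ =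
  +-mono-≤ (+-mono-≤ (+-monoˡ-≤ 13 (*-monoʳ-≤ 4 n≤)) (*-mono-≤ n≤ (+-monoˡ-≤ 6 (*-monoʳ-≤ 2 n≤))))
    (s≤s (+-mono-≤ (*-mono-≤ u≤ (+-monoˡ-≤ 8 (+-mono-≤ (*-monoʳ-≤ 2 κ≤) (*-monoʳ-≤ 2 u≤))))
                   (s≤s (s≤s (+-monoˡ-≤ 1 w≤)))))

steps≡runtime : ∀ N → steps N N ((3 + N) * (3 + N)) ((3 + N) * (4 + N)) ≡ eval runtime N
steps≡runtime = expanded
  where
  expanded : ∀ N → 4 * N + 13 + N * (2 * N + 6) +
    (1 + ((3 + N) * (3 + N) * (2 * N + 2 * ((3 + N) * (3 + N)) + 8) + (2 + ((3 + N) * (4 + N) + 1)))) ≡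
    263 + N * (299 + N * (131 + N * (26 + N * (2 + N * 0))))
  expanded = solve-∀

module _ {n} (M : Fin n → Fin n → Bool) (k : ℕ) where

  private
    K = encodeℕᵇ (Bin.fromℕ k)
    input = lines M (♯ ∷ K)
    graphText = lines (graph M) []

  graphBound : ℕ
  graphBound = tally (tri (3 + n)) (ones (graphText ʳ++ [])) k 0

  digit-count≤ : length (digits (Bin.fromℕ k)) ≤ length input
  digit-count≤ = ≤-trans (≤-reflexive (length-digits (Bin.fromℕ k)))
    (≤-trans (≤-trans (n≤1+n _) (m≤n+m _ (n * suc n))) (≤-reflexive (sym (length-lines M (♯ ∷ K)))))

  size≤ : n ≤ length input
  size≤ = ≤-trans (≤-trans (m≤m*n n (suc n)) (m≤m+n (n * suc n) _)) (≤-reflexive (sym (length-lines M (♯ ∷ K))))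

  counter : ∀ {l} → Remaining (length (digits (Bin.fromℕ k))) k (at (mark ∷ l) (map letter K))
  counter {l} = subst₂ (Remaining _)
    (trans (value-digits (Bin.fromℕ k)) (Bin.toℕ-fromℕ k))
    (cong (at (mark ∷ l)) (sym (symbol-digits (Bin.fromℕ k))))
    (digits-left ≤-refl)

  start-count : ∀ {h l t} → let w = graphText ʳ++ []; u = pushes M (λ x → x) (headerPushes n) in
    Produces (cfg r₀ (at (h ∷ l) (map letter (♯ ∷ K))) w u t)
             (suc (u * (2 * length (digits (Bin.fromℕ k)) + 2 * u + 8) + (2 + (length w + 1))))
             (w ʳ++ ♯ ∷ encodeℕᵇ (Bin.fromℕ' (tally u (ones w) k 0)))
  start-count
    with e , run , stop , holds ←
      count (length (digits (Bin.fromℕ k))) (pushes M (λ x → x) (headerPushes n)) (graphText ʳ++ [])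
            (pushes M (λ x → x) (headerPushes n)) (ones (graphText ʳ++ [])) counter 0 (≤-reflexive (+-identityʳ _))
    = e , (refl ▹ run) , stop , holds

  computes : OutputsOnWithin reducer (lines (graph M) (♯ ∷ encodeℕᵇ (Bin.fromℕ graphBound))) input
                             (eval runtime (length input))
  computes
    with h , l , t , to-r₀ ← matrix M K
    with d , from-r₀ , stop , holds ← start-count {h} {l} {t}
    with t , t≤ , run ← halts (to-r₀ ▹▹ from-r₀) stop =
    t , d , ≤-trans t≤ time , run , subst (Holds (outputTape reducer d)) text holds
    where
    u = pushes M (λ x → x) (headerPushes n)

    text : (graphText ʳ++ []) ʳ++ ♯ ∷ encodeℕᵇ (Bin.fromℕ' (tally u (ones (graphText ʳ++ [])) k 0)) ≡
           lines (graph M) (♯ ∷ encodeℕᵇ (Bin.fromℕ graphBound))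
    text rewrite all-pushes M | Bin.fromℕ≡fromℕ' graphBound =
      trans (ʳ++-ʳ++ graphText) (lines-++ (graph M) [] _)

    time : steps n (length (digits (Bin.fromℕ k))) u (length (graphText ʳ++ [])) ≤ eval runtime (length input)
    time = ≤-trans
      (steps-mono size≤ digit-count≤
        (≤-trans (≤-reflexive (all-pushes M))
                 (≤-trans (tri≤ (3 + n)) (*-mono-≤ (+-monoʳ-≤ 3 size≤) (+-monoʳ-≤ 3 size≤))))
        (≤-trans (≤-reflexive (trans (length-ʳ++ graphText) (trans (+-identityʳ _)
                   (trans (length-lines (graph M) []) (+-identityʳ _)))))
                 (*-mono-≤ (+-monoʳ-≤ 3 size≤) (+-monoʳ-≤ 4 size≤))))
      (≤-reflexive (steps≡runtime (length input)))

-- Counting pairs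

indicator : Bool → ℕ
indicator false = 0
indicator true  = 1

∑₂ : ∀ {m n} → (Fin m → Fin n → ℕ) → ℕ
∑₂ f = sum (λ x → sum (f x))

size : ∀ {m n} → (Fin m → Fin n → Bool) → ℕ
size r = ∑₂ (λ x y → indicator (r x y))

∑< : ∀ {n} → (Fin n → Fin n → ℕ) → ℕ
∑< {zero}  f = 0
∑< {suc n} f = sum (λ y → f zero (suc y)) + ∑< (λ x y → f (suc x) (suc y))

ones-++ : ∀ v w → ones (v ++ w) ≡ ones v + ones w
ones-++ []      w = refl
ones-++ (𝟘 ∷ v) w = ones-++ v w
ones-++ (𝟙 ∷ v) w = cong suc (ones-++ v w)
ones-++ (♯ ∷ v) w = ones-++ v w

ones-∷ : ∀ x w → ones (x ∷ w) ≡ ones (x ∷ []) + ones w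
ones-∷ 𝟘 w = refl
ones-∷ 𝟙 w = refl
ones-∷ ♯ w = refl

ones-ʳ++ : ∀ v w → ones (v ʳ++ w) ≡ ones v + ones w
ones-ʳ++ []      w = refl
ones-ʳ++ (x ∷ v) w = begin
  ones (v ʳ++ x ∷ w)                    ≡⟨ ones-ʳ++ v (x ∷ w) ⟩
  ones v + ones (x ∷ w)                 ≡⟨ cong (ones v +_) (ones-∷ x w) ⟩
  ones v + (ones (x ∷ []) + ones w)     ≡⟨ lemma (ones v) (ones (x ∷ [])) (ones w) ⟩
  ones (x ∷ []) + ones v + ones w       ≡⟨ cong (_+ ones w) (ones-∷ x v) ⟨
  ones (x ∷ v) + ones w                 ∎
  where
  open ≡-Reasoning
  lemma : ∀ a b c → a + (b + c) ≡ b + a + c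
  lemma = solve-∀

ones-bits : ∀ {n} (g : Fin n → Bool) → ones (tabulate (bit ∘ g)) ≡ sum (indicator ∘ g)
ones-bits {zero}  g = refl
ones-bits {suc n} g with g zero
... | false = ones-bits (g ∘ suc)
... | true  = cong suc (ones-bits (g ∘ suc))

ones-lines : ∀ {m n} (r : Fin m → Fin n → Bool) → ones (lines r []) ≡ size r
ones-lines {zero}  r = refl
ones-lines {suc m} r =
  trans (ones-++ (tabulate (bit ∘ r zero)) (♯ ∷ lines (r ∘ suc) []))
        (cong₂ _+_ (ones-bits (r zero)) (ones-lines (r ∘ suc)))

module _ {ℓ n} {_∼_ : Rel (Fin n) ℓ} (_∼?_ : Decidable _∼_) where

  related : Fin n → Fin n → Bool
  related x y = does (x ∼? y)

  encodeRel≡lines : ∀ w → encodeRel _∼?_ ++ w ≡ lines related w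
  encodeRel≡lines w = rows id
    where
    rows : ∀ {m} (f : Fin m → Fin n) →
           concatMap (λ x → map (bit ∘ related x) (allFin n) ++ ♯ ∷ []) (tabulate f) ++ w ≡
           lines (related ∘ f) w
    rows {zero}  f = refl
    rows {suc m} f = begin
      ((map (bit ∘ related (f zero)) (allFin n) ++ ♯ ∷ []) ++ rest) ++ w
        ≡⟨ ++-assoc (map (bit ∘ related (f zero)) (allFin n) ++ ♯ ∷ []) rest w ⟩
      (map (bit ∘ related (f zero)) (allFin n) ++ ♯ ∷ []) ++ rest ++ w
        ≡⟨ ++-assoc (map (bit ∘ related (f zero)) (allFin n)) (♯ ∷ []) (rest ++ w) ⟩
      map (bit ∘ related (f zero)) (allFin n) ++ ♯ ∷ rest ++ w
        ≡⟨ cong₂ (λ r s → r ++ ♯ ∷ s) (map-tabulate id (bit ∘ related (f zero))) (rows (f ∘ suc)) ⟩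
      lines (related ∘ f) w ∎
      where
      open ≡-Reasoning
      rest = concatMap (λ x → map (bit ∘ related x) (allFin n) ++ ♯ ∷ []) (tabulate (f ∘ suc))

  private
    pair? : ∀ p → Dec (uncurry _∼_ p)
    pair? (x , y) = x ∼? y

  ∣∣≡size : ∣ _∼?_ ∣ ≡ size related
  ∣∣≡size = rows id
    where
    row-count : ∀ {k} x (g : Fin k → Fin n) →
                length (filter pair? (map (x ,_) (tabulate g))) ≡ sum (indicator ∘ related x ∘ g)
    row-count {zero}  x g = refl
    row-count {suc k} x g with does (x ∼? g zero)
    ... | false = row-count x (g ∘ suc)
    ... | true  = cong suc (row-count x (g ∘ suc))

    rows : ∀ {m} (f : Fin m → Fin n) →
           length (filter pair? (cartesianProduct (tabulate f) (allFin n))) ≡ size (related ∘ f)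
    rows {zero}  f = refl
    rows {suc m} f = begin
      length (filter pair? (first ++ rest))                        ≡⟨ cong length (filter-++ pair? first rest) ⟩
      length (filter pair? first ++ filter pair? rest)             ≡⟨ length-++ (filter pair? first) ⟩
      length (filter pair? first) + length (filter pair? rest)     ≡⟨ cong₂ _+_ (row-count (f zero) id) (rows (f ∘ suc)) ⟩
      size (related ∘ f)                                           ∎
      where
      open ≡-Reasoning
      first = map (f zero ,_) (allFin n)
      rest  = cartesianProduct (tabulate (f ∘ suc)) (allFin n)

sum-0 : ∀ n → sum {n} (λ _ → 0) ≡ 0
sum-0 zero    = refl
sum-0 (suc n) = sum-0 n

sum-1 : ∀ n → sum {n} (λ _ → 1) ≡ n
sum-1 zero    = refl
sum-1 (suc n) = cong suc (sum-1 n)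

sum-mono-≤ : ∀ {n} {f g : Fin n → ℕ} → (∀ i → f i ≤ g i) → sum f ≤ sum g
sum-mono-≤ {zero}  f≤g = z≤n
sum-mono-≤ {suc n} f≤g = +-mono-≤ (f≤g zero) (sum-mono-≤ (f≤g ∘ suc))

sum-mono-< : ∀ {n} {f g : Fin n → ℕ} → (∀ i → f i ≤ g i) → ∀ j → f j < g j → sum f < sum g
sum-mono-< f≤g zero    f<g = +-mono-<-≤ f<g (sum-mono-≤ (f≤g ∘ suc))
sum-mono-< f≤g (suc j) f<g = +-mono-≤-< (f≤g zero) (sum-mono-< (f≤g ∘ suc) j f<g)

∑<-cong : ∀ {n} {f g : Fin n → Fin n → ℕ} → (∀ {x y} → x Fin.< y → f x y ≡ g x y) → ∑< f ≡ ∑< g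
∑<-cong {zero}  f≡g = refl
∑<-cong {suc n} f≡g = cong₂ _+_ (sum-cong-≗ (λ y → f≡g {zero} {suc y} z<s)) (∑<-cong (λ x<y → f≡g (s<s x<y)))

∑<-mono-≤ : ∀ {n} {f g : Fin n → Fin n → ℕ} → (∀ x y → f x y ≤ g x y) → ∑< f ≤ ∑< g
∑<-mono-≤ {zero}  f≤g = z≤n
∑<-mono-≤ {suc n} f≤g = +-mono-≤ (sum-mono-≤ (f≤g zero ∘ suc)) (∑<-mono-≤ (λ x y → f≤g (suc x) (suc y)))

∑<-1 : ∀ n → ∑< {n} (λ _ _ → 1) ≡ tri n
∑<-1 zero    = refl
∑<-1 (suc n) = cong₂ _+_ (sum-1 n) (∑<-1 n)

∑<-+ : ∀ {n} (f g : Fin n → Fin n → ℕ) → ∑< (λ x y → f x y + g x y) ≡ ∑< f + ∑< g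
∑<-+ {zero}  f g = refl
∑<-+ {suc n} f g = trans
  (cong₂ _+_ (∑-distrib-+ (f zero ∘ suc) (g zero ∘ suc))
             (∑<-+ (λ x y → f (suc x) (suc y)) (λ x y → g (suc x) (suc y))))
  (lemma (sum (f zero ∘ suc)) (sum (g zero ∘ suc)) _ _)
  where
  lemma : ∀ a b c d → a + b + (c + d) ≡ a + c + (b + d)
  lemma = solve-∀

∑₂-split : ∀ {n} (f : Fin n → Fin n → ℕ) → ∑₂ f ≡ sum (λ x → f x x) + ∑< (λ x y → f x y + f y x)
∑₂-split {zero}  f = refl
∑₂-split {suc n} f = begin
  f zero zero + top + sum (λ x → f (suc x) zero + sum (f (suc x) ∘ suc))
    ≡⟨ cong (f zero zero + top +_) (∑-distrib-+ (λ x → f (suc x) zero) _) ⟩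
  f zero zero + top + (side + ∑₂ inner)
    ≡⟨ cong (λ s → f zero zero + top + (side + s)) (∑₂-split inner) ⟩
  f zero zero + top + (side + (diagonal + pairs))
    ≡⟨ lemma (f zero zero) top side diagonal pairs ⟩
  f zero zero + diagonal + (top + side + pairs)
    ≡⟨ cong (λ s → f zero zero + diagonal + (s + pairs))
            (∑-distrib-+ (f zero ∘ suc) (λ x → f (suc x) zero)) ⟨
  sum (λ x → f x x) + ∑< (λ x y → f x y + f y x) ∎
  where
  open ≡-Reasoning
  inner : Fin n → Fin n → ℕ
  inner x y = f (suc x) (suc y)
  top      = sum (f zero ∘ suc)
  side     = sum (λ x → f (suc x) zero)
  diagonal = sum (λ x → inner x x)
  pairs    = ∑< (λ x y → inner x y + inner y x)

  lemma : ∀ a t l d p → a + t + (l + (d + p)) ≡ a + d + (t + l + p)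
  lemma = solve-∀

∑₂-irreflexive : ∀ {n} (f : Fin n → Fin n → ℕ) → (∀ x → f x x ≡ 0) → ∑₂ f ≡ ∑< (λ x y → f x y + f y x)
∑₂-irreflexive {n} f f≡0 = trans (∑₂-split f)
  (cong (_+ ∑< (λ x y → f x y + f y x)) (trans (sum-cong-≗ f≡0) (sum-0 n)))

-- Of the two orientations of a pair only the increasing one passes the test. This is the form that
-- `dist` takes as a sum.
size-upper : ∀ {n} (r : Fin n → Fin n → Bool) →
             size (λ x y → does (x Fin.<? y) ∧ r x y) ≡ ∑< (λ x y → indicator (r x y))
size-upper r = trans
  (∑₂-irreflexive _ (λ x → cong (λ b → indicator (b ∧ r x x)) (dec-false (x Fin.<? x) (n≮n _))))
  (∑<-cong upper)
  where
  upper : ∀ {x y} → x Fin.< y →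
          indicator (does (x Fin.<? y) ∧ r x y) + indicator (does (y Fin.<? x) ∧ r y x) ≡ indicator (r x y)
  upper {x} {y} x<y rewrite dec-true (x Fin.<? y) x<y | dec-false (y Fin.<? x) (<-asym x<y) = +-identityʳ _

tri-closed : ∀ n → tri n ≡ n * (n ∸ 1) / 2
tri-closed n = trans (sym (m*n/n≡m (tri n) 2)) (cong (_/ 2) (doubled n))
  where
  lemma : ∀ n t → (suc n + t) * 2 ≡ 2 + n + n + t * 2
  lemma = solve-∀

  lemma′ : ∀ n → 2 + n + n + suc n * n ≡ suc (suc n) * suc n
  lemma′ = solve-∀

  doubled : ∀ n → tri n * 2 ≡ n * (n ∸ 1)
  doubled zero          = refl
  doubled (suc zero)    = refl
  doubled (suc (suc n)) = trans (lemma n (tri (suc n))) (trans (cong (2 + n + n +_) (doubled (suc n))) (lemma′ n))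

-- Orders and topological sortings

-- Adds k least elements 0 < 1 < … below Q.
chain : ∀ k {n} → Rel (Fin n) 0ℓ → Rel (Fin (k + n)) 0ℓ
chain zero    Q u       v       = Q u v
chain (suc k) Q zero    zero    = ⊥
chain (suc k) Q zero    (suc v) = ⊤
chain (suc k) Q (suc u) zero    = ⊥
chain (suc k) Q (suc u) (suc v) = chain k Q u v

chain-trans : ∀ k {n} {Q : Rel (Fin n) 0ℓ} → Transitive Q → Transitive (chain k Q)
chain-trans zero    Q-trans p q = Q-trans p q
chain-trans (suc k) Q-trans {zero}  {suc v} {suc w} p q = tt
chain-trans (suc k) Q-trans {suc u} {suc v} {suc w} p q = chain-trans k Q-trans p q

chain-irrefl : ∀ k {n} {Q : Rel (Fin n) 0ℓ} → (∀ x → ¬ Q x x) → ∀ u → ¬ chain k Q u u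
chain-irrefl zero    irrefl u       = irrefl u
chain-irrefl (suc k) irrefl (suc u) = chain-irrefl k irrefl u

lift-mono : ∀ k {m n} {Q : Rel (Fin m) 0ℓ} (f : Fin m → Fin n) → (∀ {x y} → Q x y → f x Fin.< f y) →
            ∀ {u v} → chain k Q u v → Fin.lift k f u Fin.< Fin.lift k f v
lift-mono zero    f f-mono p = f-mono p
lift-mono (suc k) f f-mono {zero}  {suc v} p = z<s
lift-mono (suc k) f f-mono {suc u} {suc v} p = s<s (lift-mono k f f-mono p)

-- Pigeonhole: if y were missed, punching it out of the codomain would inject `Fin (suc n)` into
-- `Fin n`.
injective⇒strictlySurjective : ∀ {n} (f : Fin n → Fin n) → Injective _≡_ _≡_ f → ∀ y → ∃[ x ] f x ≡ y
injective⇒strictlySurjective {suc n} f inj y with Fin.any? (λ x → f x Fin.≟ y)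
... | yes hit  = hit
... | no  miss = contradiction
  (Fin.injective⇒≤ {f = λ x → Fin.punchOut (avoid x)}
    (λ {x} {x′} eq → inj (Fin.punchOut-injective (avoid x) (avoid x′) eq)))
  1+n≰n
  where
  avoid : ∀ x → y ≢ f x
  avoid x eq = miss (x , sym eq)

sorting : ∀ {n} {Edge : Rel (Fin n) 0ℓ} (f : Fin n → Fin n) → Injective _≡_ _≡_ f →
          (∀ {u v} → Edge u v → f u Fin.< f v) → TopologicalSorting Edge
sorting f inj f-mono = record
  { bijection = mk⤖ (inj , strictlySurjective⇒surjective (injective⇒strictlySurjective f inj))
  ; monotone  = f-mono
  }

module _ {n} (p : Fin n → Fin n) where

  before : Fin n → Fin n → Bool
  before x y = does (p x Fin.<? p y)

  before-irrefl : ∀ x → before x x ≡ false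
  before-irrefl x = dec-false (p x Fin.<? p x) (n≮n _)

  before-flip : Injective _≡_ _≡_ p → ∀ {x y} → x ≢ y → before y x ≡ not (before x y)
  before-flip inj {x} {y} x≢y with Fin.<-cmp (p x) (p y)
  ... | tri< x<y _ y≮x rewrite dec-true (p x Fin.<? p y) x<y = dec-false (p y Fin.<? p x) y≮x
  ... | tri≈ _ x≡y _   = contradiction (inj x≡y) x≢y
  ... | tri> x≮y _ y<x rewrite dec-false (p x Fin.<? p y) x≮y = dec-true (p y Fin.<? p x) y<x

module _ {n} (p q : Fin n → Fin n) where

  agreeing reversed : Fin n → Fin n → Bool
  agreeing x y = before p x y ∧ before q x y
  reversed x y = (before p x y ∧ before q y x) ∨ (before p y x ∧ before q x y)

  -- A pair of distinct elements is either reversed or ordered alike by p and q, and in the latter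
  -- case exactly one of its orientations is counted by `agreeing`.
  agreeing+reversed : Injective _≡_ _≡_ p → Injective _≡_ _≡_ q →
                      size agreeing + ∑< (λ x y → indicator (reversed x y)) ≡ tri n
  agreeing+reversed p-inj q-inj = begin
    size agreeing + ∑< opposite
      ≡⟨ cong (_+ ∑< opposite) (∑₂-irreflexive _ λ x → 
                                     cong (λ b → indicator (b ∧ before q x x)) (before-irrefl p x)) ⟩
    ∑< same + ∑< opposite
      ≡⟨ ∑<-+ same opposite ⟨
    ∑< (λ x y → same x y + opposite x y)
      ≡⟨ ∑<-cong {f = λ x y → same x y + opposite x y} (λ x<y → exactly-one (λ { refl → n≮n _ x<y })) ⟩
    ∑< {n} (λ _ _ → 1)
      ≡⟨ ∑<-1 n ⟩
    tri n ∎
    where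
    open ≡-Reasoning
    same opposite : Fin n → Fin n → ℕ
    same x y     = indicator (agreeing x y) + indicator (agreeing y x)
    opposite x y = indicator (reversed x y)

    exactly-one : ∀ {x y} → x ≢ y → same x y + opposite x y ≡ 1
    exactly-one {x} {y} x≢y rewrite before-flip p p-inj x≢y | before-flip q q-inj x≢y
      with before p x y | before q x y
    ... | false | false = refl
    ... | false | true  = refl
    ... | true  | false = refl
    ... | true  | true  = refl

  ordered⇒¬reversed : ∀ {x y} → p x Fin.< p y → q x Fin.< q y → reversed x y ≡ false
  ordered⇒¬reversed {x} {y} px<py qx<qy
    rewrite dec-false (p y Fin.<? p x) (<-asym px<py) | dec-false (q y Fin.<? q x) (<-asym qx<qy)
    with before p x y
  ... | false = refl
  ... | true  = refl

-- Without loops and 2-cycles, every unordered pair carries at most one edge.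
acyclic-size : ∀ {n} {Edge : Rel (Fin n) 0ℓ} (edge? : Decidable Edge) → (∀ v → ¬ TransClosure Edge v v) →
               size (related edge?) ≤ tri n
acyclic-size {n} edge? acyclic = begin
  size (related edge?)
    ≡⟨ ∑₂-irreflexive _ (λ x → cong indicator (dec-false (edge? x x) (λ e → acyclic x [ e ]))) ⟩
  ∑< (λ x y → indicator (related edge? x y) + indicator (related edge? y x))
    ≤⟨ ∑<-mono-≤ at-most-one ⟩
  ∑< {n} (λ _ _ → 1)
    ≡⟨ ∑<-1 n ⟩
  tri n ∎
  where
  open ≤-Reasoning
  at-most-one : ∀ x y → indicator (related edge? x y) + indicator (related edge? y x) ≤ 1
  at-most-one x y with edge? x y | edge? y x
  ... | yes e | yes e′ = contradiction (e ∷ [ e′ ]) (acyclic x)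
  ... | yes _ | no  _  = ≤-refl
  ... | no  _ | yes _  = ≤-refl
  ... | no  _ | no  _  = z≤n

indicator-mono : ∀ {b c} → (T b → T c) → indicator b ≤ indicator c
indicator-mono {false}        b⇒c = z≤n
indicator-mono {true} {false} b⇒c = ⊥-elim (b⇒c tt)
indicator-mono {true} {true}  b⇒c = ≤-refl

indicator≤1 : ∀ b → indicator b ≤ 1
indicator≤1 false = z≤n
indicator≤1 true  = ≤-refl

module Rank {n} {_⊑_ : Rel (Fin n) 0ℓ} (isDecTotalOrder : IsDecTotalOrder _≡_ _⊑_) where
  open IsDecTotalOrder isDecTotalOrder using (total; antisym) renaming (_≤?_ to _⊑?_; refl to ⊑-refl; trans to ⊑-trans)

  -- By totality, the failure of `y ⊑ x` means that x lies strictly below y. Counting such elements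
  -- turns the order into positions.
  strictlyBelow : Fin n → Fin n → Bool
  strictlyBelow x y = not (does (y ⊑? x))

  rankℕ : Fin n → ℕ
  rankℕ x = sum (λ y → indicator (strictlyBelow y x))

  strictlyBelow-irrefl : ∀ x → strictlyBelow x x ≡ false
  strictlyBelow-irrefl x = cong not (dec-true (x ⊑? x) ⊑-refl)

  rankℕ<n : ∀ x → rankℕ x < n
  rankℕ<n x = subst (rankℕ x <_) (sum-1 n)
    (sum-mono-< (λ y → indicator≤1 (strictlyBelow y x)) x
                (subst (λ b → indicator b < 1) (sym (strictlyBelow-irrefl x)) ≤-refl))

  -- Whatever lies strictly below x lies strictly below y, and x itself makes the inclusion proper.
  rankℕ-mono : ∀ {x y} → ¬ (y ⊑ x) → rankℕ x < rankℕ y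
  rankℕ-mono {x} {y} y⋢x = sum-mono-< below x
    (subst₂ (λ b c → indicator b < indicator c) (sym (strictlyBelow-irrefl x))
            (sym (cong not (dec-false (y ⊑? x) y⋢x))) ≤-refl)
    where
    below : ∀ z → indicator (strictlyBelow z x) ≤ indicator (strictlyBelow z y)
    below z with x ⊑? z | y ⊑? z
    ... | yes _   | _       = z≤n
    ... | no  _   | no  _   = ≤-refl
    ... | no  x⋢z | yes y⊑z with total x y
    ...   | inj₁ x⊑y = contradiction (⊑-trans x⊑y y⊑z) x⋢z
    ...   | inj₂ y⊑x = contradiction y⊑x y⋢x

  rank : Fin n → Fin n
  rank x = Fin.fromℕ< (rankℕ<n x)

  rank-mono : ∀ {x y} → x ⊑ y → x ≢ y → rank x Fin.< rank y
  rank-mono {x} {y} x⊑y x≢y = subst₂ _<_ (sym (Fin.toℕ-fromℕ< (rankℕ<n x))) (sym (Fin.toℕ-fromℕ< (rankℕ<n y)))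
    (rankℕ-mono (λ y⊑x → x≢y (antisym x⊑y y⊑x)))

  rank-cancel : ∀ {x y} → rank x Fin.< rank y → x ⊑ y
  rank-cancel {x} {y} rx<ry with total x y | x Fin.≟ y
  ... | inj₁ x⊑y | _        = x⊑y
  ... | inj₂ _   | yes refl = ⊑-refl
  ... | inj₂ y⊑x | no  x≢y  = contradiction rx<ry (<-asym (rank-mono y⊑x (x≢y ∘ sym)))

  rank-injective : Injective _≡_ _≡_ rank
  rank-injective {x} {y} eq with x Fin.≟ y | total x y
  ... | yes x≡y | _        = x≡y
  ... | no  x≢y | inj₁ x⊑y = contradiction (rank-mono x⊑y x≢y) (subst (λ r → ¬ (r Fin.< rank y)) (sym eq) (n≮n _))
  ... | no  x≢y | inj₂ y⊑x = contradiction (rank-mono y⊑x (x≢y ∘ sym)) (subst (λ r → ¬ (rank y Fin.< r)) (sym eq) (n≮n _))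

tally≡ : ∀ {u d} v e → d ≤ u → tally u d v e ≡ e + (d + (u ∸ d ∸ v))
tally≡ {zero}  {zero}  v       e _         = trans (sym (+-identityʳ e)) (cong (e +_) (sym (0∸n≡0 v)))
tally≡ {suc u} {suc d} v       e (s≤s d≤u) = trans (tally≡ v (suc e) d≤u) (sym (+-suc e _))
tally≡ {suc u} {zero}  (suc v) e _         = tally≡ v e z≤n
tally≡ {suc u} {zero}  zero    e _         = trans (tally≡ zero (suc e) z≤n) (sym (+-suc e u))

-- The graph and its topological sortings

module _ {n} (M : Fin n → Fin n → Bool) where

  GraphEdge : Rel (Fin (3 + n)) 0ℓ
  GraphEdge u v = T (graph M u v)

  graphEdge? : Decidable GraphEdge
  graphEdge? u v = T? (graph M u v)

  -- Embeds the graph into a transitive relation, where acyclicity and monotonicity of positions are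
  -- easy to check.
  edge⇒chain : ∀ {_≺_ : Rel (Fin n) 0ℓ} → (∀ {x y} → T (offDiagonal x (M x) y) → x ≺ y) →
               ∀ u v → GraphEdge u v → chain 3 _≺_ u v
  edge⇒chain e zero                (suc zero)          _ = tt
  edge⇒chain e (suc zero)          (suc (suc zero))    _ = tt
  edge⇒chain e (suc (suc zero))    (suc (suc (suc y))) _ = tt
  edge⇒chain e (suc (suc (suc x))) (suc (suc (suc y))) t = e t

  -- Adds the implied pair (0 , 2).
  extended : Fin (3 + n) → Fin (3 + n) → Bool
  extended zero (suc (suc zero)) = true
  extended u    v                = graph M u v

  position-injective : (t : TopologicalSorting GraphEdge) → Injective _≡_ _≡_ (TopologicalSorting.position t)
  position-injective t = Bijection.injective (TopologicalSorting.bijection t)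

  gadget-first : (t : TopologicalSorting GraphEdge) → let open TopologicalSorting t in
                 (∀ v → position zero Fin.< position (suc v)) ×
                 (∀ v → position (suc zero) Fin.< position (suc (suc v))) ×
                 (∀ v → position (suc (suc zero)) Fin.< position (suc (suc (suc v))))
  gadget-first t = first , second , third
    where
    open TopologicalSorting t
    third : ∀ v → position (suc (suc zero)) Fin.< position (suc (suc (suc v)))
    third v = monotone {suc (suc zero)} {suc (suc (suc v))} tt
    second : ∀ v → position (suc zero) Fin.< position (suc (suc v))
    second zero    = monotone {suc zero} {suc (suc zero)} tt
    second (suc v) = <-trans (second zero) (third v)
    first : ∀ v → position zero Fin.< position (suc v)
    first zero    = monotone {zero} {suc zero} tt
    first (suc v) = <-trans (first zero) (second v)

  module _ (tX tY : TopologicalSorting GraphEdge) where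
    private
      module X = TopologicalSorting tX
      module Y = TopologicalSorting tY

    edges<intersection : size (graph M) < ∣ intersection? tX tY ∣
    edges<intersection = begin
      -- Setting the entry (0, 2) adds one to the sum by computation.
      suc (size (graph M))                         ≡⟨⟩
      size extended                                ≤⟨ sum-mono-≤ (λ u → sum-mono-≤ (λ v → indicator-mono (implied u v))) ⟩
      size (agreeing X.position Y.position)        ≡⟨ ∣∣≡size (intersection? tX tY) ⟨
      ∣ intersection? tX tY ∣                      ∎
      where
      open ≤-Reasoning
      ordered : ∀ {u v} → X.position u Fin.< X.position v → Y.position u Fin.< Y.position v →
                T (agreeing X.position Y.position u v)
      ordered {u} {v} pX pY rewrite dec-true (X.position u Fin.<? X.position v) pX
                                  | dec-true (Y.position u Fin.<? Y.position v) pY = tt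

      edge : ∀ u v → GraphEdge u v → T (agreeing X.position Y.position u v)
      edge u v e = ordered (X.monotone e) (Y.monotone e)

      implied : ∀ u v → T (extended u v) → T (agreeing X.position Y.position u v)
      implied zero    zero                = edge zero zero
      implied zero    (suc zero)          = edge zero (suc zero)
      implied zero    (suc (suc zero))    _ =
        ordered (<-trans (X.monotone {zero} {suc zero} tt) (X.monotone {suc zero} {suc (suc zero)} tt))
                (<-trans (Y.monotone {zero} {suc zero} tt) (Y.monotone {suc zero} {suc (suc zero)} tt))
      implied zero    (suc (suc (suc v))) = edge zero (suc (suc (suc v)))
      implied (suc u) v                   = edge (suc u) v

    reversed-above-gadget :
      ∑< (λ u v → indicator (reversed X.position Y.position u v)) ≡
      ∑< (λ x y → indicator (reversed X.position Y.position (3 Fin.↑ʳ x) (3 Fin.↑ʳ y)))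
    reversed-above-gadget
      with firstX , secondX , thirdX ← gadget-first tX
         | firstY , secondY , thirdY ← gadget-first tY =
      -- `∑<` unfolds to the pairs with least member 0, 1 and 2, none of which is reversed, and the
      -- sum over the elements of P.
      cong₂ _+_ (none _ _ firstX firstY)
        (cong₂ _+_ (none _ _ secondX secondY) (cong₂ _+_ (none _ _ thirdX thirdY) refl))
      where
      none : ∀ {k} u (v : Fin k → Fin (3 + n)) →
             (∀ i → X.position u Fin.< X.position (v i)) → (∀ i → Y.position u Fin.< Y.position (v i)) →
             sum (λ i → indicator (reversed X.position Y.position u (v i))) ≡ 0
      none {k} u v pX pY = trans
        (sum-cong-≗ (λ i → cong indicator (ordered⇒¬reversed X.position Y.position (pX i) (pY i)))) (sum-0 k)

  -- Equal elements are excluded because `_⊑_` is reflexive, whereas `before` is irreflexive.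
  Agrees : {_≼_ : Rel (Fin n) 0ℓ} → LinearExtension _≼_ → TopologicalSorting GraphEdge → Set
  Agrees ext t = ∀ {x y} → x ≢ y →
    does (LinearExtension._⊑?_ ext x y) ≡ before (TopologicalSorting.position t) (3 Fin.↑ʳ x) (3 Fin.↑ʳ y)

  -- By agreement, the distance counts the pairs of elements of P that are reversed by the sortings,
  -- and these are all reversed pairs.
  intersection+dist : {_≼_ : Rel (Fin n) 0ℓ} (L₁ L₂ : LinearExtension _≼_) (tX tY : TopologicalSorting GraphEdge) →
                      Agrees L₁ tX → Agrees L₂ tY → ∣ intersection? tX tY ∣ + dist L₁ L₂ ≡ tri (3 + n)
  intersection+dist L₁ L₂ tX tY agree₁ agree₂ = begin
    ∣ intersection? tX tY ∣ + dist L₁ L₂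
      ≡⟨ cong₂ _+_ (∣∣≡size (intersection? tX tY)) (∣∣≡size (reversed? L₁ L₂)) ⟩
    size (agreeing X.position Y.position) + size (related (reversed? L₁ L₂))
      ≡⟨ cong (size (agreeing X.position Y.position) +_) (size-upper disagreeing) ⟩
    size (agreeing X.position Y.position) + ∑< (λ x y → indicator (disagreeing x y))
      ≡⟨ cong (size (agreeing X.position Y.position) +_)
           (∑<-cong {g = λ x y → indicator (reversed X.position Y.position (3 Fin.↑ʳ x) (3 Fin.↑ʳ y))}
             (λ x<y → cong indicator (same (λ { refl → n≮n _ x<y })))) ⟩
    size (agreeing X.position Y.position) +
      ∑< (λ x y → indicator (reversed X.position Y.position (3 Fin.↑ʳ x) (3 Fin.↑ʳ y)))
      ≡⟨ cong (size (agreeing X.position Y.position) +_) (reversed-above-gadget tX tY) ⟨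
    size (agreeing X.position Y.position) + ∑< (λ u v → indicator (reversed X.position Y.position u v))
      ≡⟨ agreeing+reversed X.position Y.position (position-injective tX) (position-injective tY) ⟩
    tri (3 + n) ∎
    where
    open ≡-Reasoning
    module X = TopologicalSorting tX
    module Y = TopologicalSorting tY
    module L₁ = LinearExtension L₁
    module L₂ = LinearExtension L₂

    disagreeing : Fin n → Fin n → Bool
    disagreeing x y = (does (x L₁.⊑? y) ∧ does (y L₂.⊑? x)) ∨ (does (y L₁.⊑? x) ∧ does (x L₂.⊑? y))

    same : ∀ {x y} → x ≢ y → disagreeing x y ≡ reversed X.position Y.position (3 Fin.↑ʳ x) (3 Fin.↑ʳ y)
    same x≢y = cong₂ _∨_ (cong₂ _∧_ (agree₁ x≢y) (agree₂ (x≢y ∘ sym)))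
                         (cong₂ _∧_ (agree₁ (x≢y ∘ sym)) (agree₂ x≢y))

threshold : ∀ {e i t d k} → e < i → e ≤ t → i + d ≡ t → i ≤ e + (t ∸ e ∸ k) → k ≤ d
threshold {e} {i} {t} {d} {k} e<i e≤t i+d≡t i≤ with t ∸ e ∸ k in eq
-- The bound on i has collapsed to e, which i exceeds.
... | zero  = contradiction e<i (≤⇒≯ (≤-trans i≤ (≤-reflexive (+-identityʳ e))))
-- A positive difference rules out truncation, so k can be added back.
... | suc s = +-cancelˡ-≤ i k d (begin
  i + k                ≤⟨ +-monoˡ-≤ k i≤ ⟩
  e + suc s + k        ≡⟨ cong (λ s → e + s + k) eq ⟨
  e + (t ∸ e ∸ k) + k  ≡⟨ +-assoc e (t ∸ e ∸ k) k ⟩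
  e + (t ∸ e ∸ k + k)  ≡⟨ cong (e +_) (m∸n+n≡m (<⇒≤ (m∸n≢0⇒n<m {t ∸ e} {k} (λ z → 0≢1+n (trans (sym z) eq))))) ⟩
  e + (t ∸ e)          ≡⟨ m+[n∸m]≡n e≤t ⟩
  t                    ≡⟨ i+d≡t ⟨
  i + d                ∎)
  where open ≤-Reasoning

-- The reduction and its correctness

module _ (I : LEDInstance) where
  open LEDInstance I renaming (size to n)
  open IsDecPartialOrder isDecPartialOrder using (antisym) renaming (refl to ≼-refl; trans to ≼-trans)

  order-matrix : Fin n → Fin n → Bool
  order-matrix x y = does (x ≼? y)

  _≺_ : Rel (Fin n) 0ℓ
  x ≺ y = x ≢ y × x ≼ y

  ≺-trans : Transitive _≺_
  ≺-trans (x≢y , x≼y) (y≢z , y≼z) = (λ { refl → x≢y (antisym x≼y y≼z) }) , ≼-trans x≼y y≼z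

  offDiagonal⇒≺ : ∀ {x y} → T (offDiagonal x (order-matrix x) y) → x ≺ y
  offDiagonal⇒≺ {x} {y} t with x Fin.≟ y | x ≼? y
  ... | no x≢y | yes x≼y = x≢y , x≼y

  ≺⇒offDiagonal : ∀ {x y} → x ≺ y → T (offDiagonal x (order-matrix x) y)
  ≺⇒offDiagonal {x} {y} (x≢y , x≼y) rewrite dec-false (x Fin.≟ y) x≢y | dec-true (x ≼? y) x≼y = tt

  acyclic : ∀ v → ¬ TransClosure (GraphEdge order-matrix) v v
  acyclic v path = chain-irrefl 3 {Q = _≺_} (λ x x≺x → proj₁ x≺x refl) v (chained path)
    where
    chained : ∀ {u v} → TransClosure (GraphEdge order-matrix) u v → chain 3 _≺_ u v
    chained {u} {v} [ e ]                = edge⇒chain order-matrix offDiagonal⇒≺ u v e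
    chained {u}     (_∷_ {y = w} e path) =
      chain-trans 3 {Q = _≺_} ≺-trans {u} {w} (edge⇒chain order-matrix offDiagonal⇒≺ u w e) (chained path)

  edges : ℕ
  edges = size (graph order-matrix)

  edges≤tri : edges ≤ tri (3 + n)
  edges≤tri = acyclic-size (graphEdge? order-matrix) acyclic

  graphBound≡ : graphBound order-matrix k ≡ edges + (tri (3 + n) ∸ edges ∸ k)
  graphBound≡ = trans
    (cong (λ d → tally (tri (3 + n)) d k 0)
      (trans (ones-ʳ++ (lines (graph order-matrix) []) []) (trans (+-identityʳ _) (ones-lines (graph order-matrix)))))
    (tally≡ k 0 edges≤tri)

  reduced : WDDInstance
  reduced = record
    { order   = 3 + n
    ; Edge    = GraphEdge order-matrix
    ; edge?   = graphEdge? order-matrix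
    ; acyclic = acyclic
    ; C       = graphBound order-matrix k
    -- The edge from 0 to 1 makes `edges` compute to a successor.
    ; C>0     = subst (0 <_) (sym graphBound≡) z<s
    ; ∣E∣≤C   = ≤-trans (≤-reflexive (∣∣≡size (graphEdge? order-matrix)))
                        (≤-trans (m≤m+n edges _) (≤-reflexive (sym graphBound≡)))
    ; C≤pairs = begin
        graphBound order-matrix k                  ≡⟨ graphBound≡ ⟩
        edges + (tri (3 + n) ∸ edges ∸ k)          ≤⟨ +-monoʳ-≤ edges (m∸n≤m _ k) ⟩
        edges + (tri (3 + n) ∸ edges)              ≡⟨ m+[n∸m]≡n edges≤tri ⟩
        tri (3 + n)                                ≡⟨ tri-closed (3 + n) ⟩
        (3 + n) * (2 + n) / 2                      ∎
    }
    where open ≤-Reasoning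

  sorting-of : (ext : LinearExtension _≼_) →
               Σ[ t ∈ TopologicalSorting (GraphEdge order-matrix) ] Agrees order-matrix ext t
  sorting-of ext =
    -- The vertices 0, 1, 2 keep the first three positions, and the elements of P follow by rank.
    sorting (Fin.lift 3 rank) (Fin.lift-injective rank rank-injective 3)
      (λ {u} {v} e → lift-mono 3 rank (λ (x≢y , x≼y) → rank-mono (extends x≼y) x≢y) {u} {v}
                       (edge⇒chain order-matrix offDiagonal⇒≺ u v e)) ,
    λ {x} {y} x≢y → does-⇔
      (mk⇔ (λ x⊑y → s<s (s<s (s<s (rank-mono x⊑y x≢y)))) (λ { (s<s (s<s (s<s r))) → rank-cancel r }))
      (x ⊑? y) (_ Fin.<? _)
    where
    open LinearExtension ext
    open Rank isDecTotalOrder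

  -- The elements of P are compared by their positions in the whole graph; only the relative order
  -- matters, so positions need no renumbering.
  extension-of : (t : TopologicalSorting (GraphEdge order-matrix)) →
                 Σ[ ext ∈ LinearExtension _≼_ ] Agrees order-matrix ext t
  extension-of t = record
    { _⊑_             = λ x y → place x Fin.≤ place y
    ; isDecTotalOrder = record
      { isTotalOrder = record
        { isPartialOrder = record
          { isPreorder = record
            { isEquivalence = isEquivalence
            ; reflexive     = λ { refl → ≤-refl }
            ; trans         = ≤-trans
            }
          ; antisym = λ p q → place-injective (Fin.≤-antisym p q)
          }
        ; total = λ x y → ≤-total (toℕ (place x)) (toℕ (place y))
        }
      ; _≟_  = Fin._≟_
      ; _≤?_ = λ x y → place x Fin.≤? place y
      }
    ; extends = extends
    } ,
    λ {x} {y} x≢y → does-⇔ (mk⇔ (λ p → Fin.≤∧≢⇒< p (x≢y ∘ place-injective)) <⇒≤)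
                             (place x Fin.≤? place y) (place x Fin.<? place y)
    where
    open TopologicalSorting t
    place : Fin n → Fin (3 + n)
    place x = position (3 Fin.↑ʳ x)

    place-injective : Injective _≡_ _≡_ place
    place-injective eq = Fin.↑ʳ-injective 3 _ _ (Bijection.injective bijection eq)

    extends : ∀ {x y} → x ≼ y → place x Fin.≤ place y
    extends {x} {y} x≼y with x Fin.≟ y
    ... | yes refl = ≤-refl
    ... | no  x≢y  = <⇒≤ (monotone {3 Fin.↑ʳ x} {3 Fin.↑ʳ y} (≺⇒offDiagonal (x≢y , x≼y)))

  yes⇒yes : Yes LED I → Yes WDD reduced
  yes⇒yes (L₁ , L₂ , k≤dist) with tX , agree₁ ← sorting-of L₁ | tY , agree₂ ← sorting-of L₂ =
    tX , tY , (begin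
      ∣ intersection? tX tY ∣             ≤⟨ m+n≤o⇒m≤o∸n _ (≤-trans (+-monoʳ-≤ _ k≤dist) (≤-reflexive
                                               (intersection+dist order-matrix L₁ L₂ tX tY agree₁ agree₂))) ⟩
      -- This holds for truncated subtraction as well, so no case distinction on the size of k is
      -- made.
      tri (3 + n) ∸ k                     ≤⟨ m≤n+m∸n _ edges ⟩
      edges + (tri (3 + n) ∸ k ∸ edges)   ≡⟨ cong (edges +_) (∸-comm (tri (3 + n)) k edges) ⟩
      edges + (tri (3 + n) ∸ edges ∸ k)   ≡⟨ graphBound≡ ⟨
      graphBound order-matrix k           ∎)
    where
    open ≤-Reasoning
    ∸-comm : ∀ a b c → a ∸ b ∸ c ≡ a ∸ c ∸ b
    ∸-comm a b c = trans (∸-+-assoc a b c) (trans (cong (a ∸_) (+-comm b c)) (sym (∸-+-assoc a c b)))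

  yes⇐yes : Yes WDD reduced → Yes LED I
  yes⇐yes (tX , tY , i≤C) with L₁ , agree₁ ← extension-of tX | L₂ , agree₂ ← extension-of tY =
    L₁ , L₂ , threshold (edges<intersection order-matrix tX tY) edges≤tri
                (intersection+dist order-matrix L₁ L₂ tX tY agree₁ agree₂)
                (≤-trans i≤C (≤-reflexive graphBound≡))

  reduction-computed : OutputsOnWithin reducer (encode WDD reduced) (encode LED I) (eval runtime (length (encode LED I)))
  reduction-computed = subst₂ (λ v w → OutputsOnWithin reducer v w (eval runtime (length w)))
    (sym (encodeRel≡lines (graphEdge? order-matrix) (♯ ∷ encodeℕᵇ (Bin.fromℕ (graphBound order-matrix k)))))
    (sym (encodeRel≡lines _≼?_ (♯ ∷ encodeℕᵇ (Bin.fromℕ k))))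
    (computes order-matrix k)

theorem1 : LED ≤ₚ WDD
theorem1 = reduced , (reducer , runtime , reduction-computed) , λ I → mk⇔ (yes⇒yes I) (yes⇐yes I)
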